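{- Let $G$ be a connected graph with $n$ vertices and let $\rho$ be an integer with $\mathrm{tb}(G)\leq \rho$. Then $G$ admits a system $\mathcal{T}(G)$ of at most $\log_2 n$ collective additive tree $(2\rho\log_2 n)$-spanners. Furthermore, such a system of collective additive tree spanners of $G$ can be constructed in polynomial time.
   Context: All graphs are finite, connected, unweighted, undirected, without loops or multiple edges; $d_G(u,v)$ denotes the shortest-path distance in $G$ and $D_r(v,G)=\{u: d_G(u,v)\le r\}$. A tree-decomposition of $G=(V,E)$ is a pair $(\{X_i\mid i\in I\},T=(I,F))$ with $T$ a tree and bags $X_i\subseteq V$ such that (1) $\bigcup_i X_i=V$; (2) every edge lies in some bag; (3) for each $v\in V$ the nodes $i$ with $v\in X_i$ induce a connected subtree of $T$. The breadth of a tree-decomposition is the minimum integer $r$ such that for every $i$ there is a vertex $v_i\in V$ with $X_i\subseteq D_r(v_i,G)$; the tree-breadth $\mathrm{tb}(G)$ is the minimum breadth over all tree-decompositions of $G$. A graph $G$ admits a system of $\mu$ collective additive tree $r$-spanners if there is a set $\mathcal{T}(G)$ of at most $\mu$ spanning trees of $G$ such that for any two vertices $x,y$ there is $T\in\mathcal{T}(G)$ with $d_T(x,y)\le d_G(x,y)+r$. -}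

module Defs where

open import Data.Bool using (Bool; true; false)
open import Data.Fin using (Fin)
open import Data.Fin.Subset using (Subset; _∈_)
open import Data.List using (List; []; _∷_; length; tabulate)
open import Data.List.Relation.Unary.All using (All)
open import Data.List.Relation.Unary.Any using (Any)
open import Data.List.Relation.Unary.Unique.Propositional using (Unique)
open import Data.Nat using (ℕ; suc; _+_; _^_; _≤_; NonZero)
open import Data.Nat.Logarithm using (⌊log₂_⌋)
open import Data.Product using (Σ; ∃-syntax; _×_; _,_)
open import Data.Sum using (_⊎_; inj₁; inj₂)
open import Data.Unit using (⊤; tt)
open import Relation.Binary.Construct.Closure.ReflexiveTransitive using (Star; ε; _◅_)
open import Relation.Binary.PropositionalEquality using (_≡_; _≢_)
open import Relation.Nullary using (¬_)

IsMinimum : (ℕ → Set) → ℕ → Set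
IsMinimum P m = P m × (∀ k → P k → m ≤ k)

-- For n ≥ 1 this is the floor of the real number k · log₂ n = log₂ (nᵏ).
-- An integer is at most a real x exactly when it is at most ⌊x⌋, so bounding
-- natural numbers by this floor is the same as bounding them by k · log₂ n.
⌊_·log₂_⌋ : ℕ → ℕ → ℕ
⌊ k ·log₂ n ⌋ = ⌊log₂ (n ^ k) ⌋

------------------------------------------------------------------------
-- Graphs

record Graph (n : ℕ) : Set where
  field
    adj         : Fin n → Fin n → Bool
    symmetric   : ∀ u v → adj u v ≡ adj v u
    irreflexive : ∀ v → adj v v ≡ false

  Edge : Fin n → Fin n → Set
  Edge u v = adj u v ≡ true

open Graph public using (adj; Edge)

Walk : ∀ {n} → Graph n → Fin n → Fin n → Set
Walk G = Star (Edge G)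

module _ {n} {R : Fin n → Fin n → Set} where

  walkLength : ∀ {u v} → Star R u v → ℕ
  walkLength ε       = 0
  walkLength (_ ◅ w) = suc (walkLength w)

  vertices : ∀ {u v} → Star R u v → List (Fin n)
  vertices {u} ε       = u ∷ []
  vertices {u} (_ ◅ w) = u ∷ vertices w

module _ {n} (G : Graph n) where

  Connected : Set
  Connected = NonZero n × (∀ u v → Walk G u v)

  -- A cycle is an edge uv together with a path of length at least 2 from v
  -- back to u.
  Acyclic : Set
  Acyclic = ∀ u v → Edge G u v → (w : Walk G v u) → Unique (vertices w) →
            ¬ (2 ≤ walkLength w)

  IsTree : Set
  IsTree = Connected × Acyclic

  Distance : Fin n → Fin n → ℕ → Set
  Distance u v = IsMinimum (λ k → Σ (Walk G u v) λ w → walkLength w ≡ k)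

  InDisk : ℕ → Fin n → Fin n → Set
  InDisk r v u = ∃[ d ] (Distance u v d × d ≤ r)

------------------------------------------------------------------------
-- Tree-decompositions and tree-breadth

record TreeDecomposition {n} (G : Graph n) : Set where
  field
    {nodes}       : ℕ
    tree          : Graph nodes
    isTree        : IsTree tree
    bag           : Fin nodes → Subset n
    coversVertex  : ∀ v → ∃[ i ] v ∈ bag i
    coversEdge    : ∀ u v → Edge G u v → ∃[ i ] (u ∈ bag i × v ∈ bag i)
    nodesSubtree  : ∀ v i j → v ∈ bag i → v ∈ bag j →
                    Σ (Walk tree i j) λ w → All (λ k → v ∈ bag k) (vertices w)

module _ {n} (G : Graph n) where

  Breadth : TreeDecomposition G → ℕ → Set
  Breadth D = IsMinimum λ r → ∀ i → ∃[ v ] (∀ u → u ∈ bag i → InDisk G r v u)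
    where open TreeDecomposition D

  TreeBreadth : ℕ → Set
  TreeBreadth = IsMinimum λ r → Σ (TreeDecomposition G) λ D → Breadth D r

------------------------------------------------------------------------
-- Collective additive tree spanners

module _ {n} (G : Graph n) where

  record IsSpanningTree (T : Graph n) : Set where
    field
      isTree   : IsTree T
      subgraph : ∀ u v → Edge T u v → Edge G u v

  AdditiveStretch : ℕ → Fin n → Fin n → Graph n → Set
  AdditiveStretch r x y T =
    ∃[ a ] ∃[ b ] (Distance T x y a × Distance G x y b × a ≤ b + r)

  -- "Any two vertices" are distinct: a one-vertex graph has the empty system,
  -- as it must for the bound log₂ 1 = 0 on the number of trees.
  record IsCollectiveTreeSpanners (μ r : ℕ) (Ts : List (Graph n)) : Set where
    field
      atMost   : length Ts ≤ μ
      spanning : All IsSpanningTree Ts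
      stretch  : ∀ x y → x ≢ y → Any (AdditiveStretch r x y) Ts

  AdmitsCollectiveTreeSpanners : ℕ → ℕ → Set
  AdmitsCollectiveTreeSpanners μ r = ∃[ Ts ] IsCollectiveTreeSpanners μ r Ts

------------------------------------------------------------------------
-- Model of computation

-- A Turing-complete first-order language over immutable pairs, tagged values
-- and lists.  Running time counts the instructions executed, including every
-- iteration of a loop.  Each instruction performs a bounded number of
-- operations on pointers (values are shared, never copied), so running time
-- agrees up to a polynomial with that of a random access or Turing machine
-- whenever inputs and outputs are written out in full.

infixr 7 _⊗_
infixr 6 _⊕_

data Ty : Set where
  𝟙       : Ty
  _⊗_ _⊕_ : Ty → Ty → Ty
  list    : Ty → Ty

⟦_⟧ : Ty → Set
⟦ 𝟙 ⟧      = ⊤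
⟦ A ⊗ B ⟧  = ⟦ A ⟧ × ⟦ B ⟧
⟦ A ⊕ B ⟧  = ⟦ A ⟧ ⊎ ⟦ B ⟧
⟦ list A ⟧ = List ⟦ A ⟧

private variable
  A B C D : Ty

infixr 5 _⨾_

data Prog : Ty → Ty → Set where
  skip   : Prog A A
  _⨾_    : Prog A B → Prog B C → Prog A C
  unit   : Prog A 𝟙
  pair   : Prog A B → Prog A C → Prog A (B ⊗ C)
  fst    : Prog (A ⊗ B) A
  snd    : Prog (A ⊗ B) B
  inl    : Prog A (A ⊕ B)
  inr    : Prog B (A ⊕ B)
  -- The second component is an environment available to both branches.
  case   : Prog (A ⊗ C) D → Prog (B ⊗ C) D → Prog ((A ⊕ B) ⊗ C) D
  nil    : Prog A (list B)
  cons   : Prog (A ⊗ list A) (list A)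
  uncons : Prog (list A) (𝟙 ⊕ (A ⊗ list A))
  -- Iterate the body until it returns a right-tagged result.
  loop   : Prog A (A ⊕ B) → Prog A B

infix 3 _⊢_⇓_⟨_⟩

-- p ⊢ x ⇓ y ⟨ t ⟩: on input x, p halts with output y after t steps.
data _⊢_⇓_⟨_⟩ : Prog A B → ⟦ A ⟧ → ⟦ B ⟧ → ℕ → Set where
  skip   : {x : ⟦ A ⟧} → skip {A} ⊢ x ⇓ x ⟨ 1 ⟩
  _⨾_    : {p : Prog A B} {q : Prog B C} {x : ⟦ A ⟧} {y : ⟦ B ⟧} {z : ⟦ C ⟧} {s t : ℕ} →
           p ⊢ x ⇓ y ⟨ s ⟩ → q ⊢ y ⇓ z ⟨ t ⟩ → p ⨾ q ⊢ x ⇓ z ⟨ suc (s + t) ⟩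
  unit   : {x : ⟦ A ⟧} → unit {A} ⊢ x ⇓ tt ⟨ 1 ⟩
  pair   : {p : Prog A B} {q : Prog A C} {x : ⟦ A ⟧} {y : ⟦ B ⟧} {z : ⟦ C ⟧} {s t : ℕ} →
           p ⊢ x ⇓ y ⟨ s ⟩ → q ⊢ x ⇓ z ⟨ t ⟩ → pair p q ⊢ x ⇓ (y , z) ⟨ suc (s + t) ⟩
  fst    : {x : ⟦ A ⟧} {y : ⟦ B ⟧} → fst {A} {B} ⊢ (x , y) ⇓ x ⟨ 1 ⟩
  snd    : {x : ⟦ A ⟧} {y : ⟦ B ⟧} → snd {A} {B} ⊢ (x , y) ⇓ y ⟨ 1 ⟩
  inl    : {x : ⟦ A ⟧} → inl {A} {B} ⊢ x ⇓ inj₁ x ⟨ 1 ⟩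
  inr    : {y : ⟦ B ⟧} → inr {B} {A} ⊢ y ⇓ inj₂ y ⟨ 1 ⟩
  case₁  : {p : Prog (A ⊗ C) D} {q : Prog (B ⊗ C) D} {x : ⟦ A ⟧} {e : ⟦ C ⟧} {z : ⟦ D ⟧} {t : ℕ} →
           p ⊢ (x , e) ⇓ z ⟨ t ⟩ → case p q ⊢ (inj₁ x , e) ⇓ z ⟨ suc t ⟩
  case₂  : {p : Prog (A ⊗ C) D} {q : Prog (B ⊗ C) D} {y : ⟦ B ⟧} {e : ⟦ C ⟧} {z : ⟦ D ⟧} {t : ℕ} →
           q ⊢ (y , e) ⇓ z ⟨ t ⟩ → case p q ⊢ (inj₂ y , e) ⇓ z ⟨ suc t ⟩
  nil    : {x : ⟦ A ⟧} → nil {A} {B} ⊢ x ⇓ [] ⟨ 1 ⟩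
  cons   : {x : ⟦ A ⟧} {xs : List ⟦ A ⟧} → cons {A} ⊢ (x , xs) ⇓ (x ∷ xs) ⟨ 1 ⟩
  uncons-[] : uncons {A} ⊢ [] ⇓ inj₁ tt ⟨ 1 ⟩
  uncons-∷  : {x : ⟦ A ⟧} {xs : List ⟦ A ⟧} → uncons {A} ⊢ (x ∷ xs) ⇓ inj₂ (x , xs) ⟨ 1 ⟩
  stop   : {p : Prog A (A ⊕ B)} {x : ⟦ A ⟧} {y : ⟦ B ⟧} {t : ℕ} →
           p ⊢ x ⇓ inj₂ y ⟨ t ⟩ → loop p ⊢ x ⇓ y ⟨ suc t ⟩
  again  : {p : Prog A (A ⊕ B)} {x x′ : ⟦ A ⟧} {y : ⟦ B ⟧} {s t : ℕ} →
           p ⊢ x ⇓ inj₁ x′ ⟨ s ⟩ → loop p ⊢ x′ ⇓ y ⟨ t ⟩ → loop p ⊢ x ⇓ y ⟨ suc (s + t) ⟩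

bit matrix : Ty
bit    = 𝟙 ⊕ 𝟙
matrix = list (list bit)

encodeBool : Bool → ⟦ bit ⟧
encodeBool false = inj₁ tt
encodeBool true  = inj₂ tt

encode : ∀ {n} → Graph n → ⟦ matrix ⟧
encode G = tabulate λ u → tabulate λ v → encodeBool (adj G u v)

{-# OPTIONS --safe #-}
module Submission where

-- A bag that halves a vertex set W lies in a disk of radius ρ, and the same disk still halves W
-- after connected parts of G have been contracted.  So take in G the first disk D, by radius,
-- each component of whose complement contains at most half of W.  A shortest path meeting D is
-- stretched by at most 2ρ in the breadth-first tree from the centre of D.  A path missing D stays
-- in one component C; contract everything outside C to a single vertex and recurse, W shrinking
-- to W ∩ C.  The trees found for the components are glued along the breadth-first tree of D.
-- A path of such a tree visits the contracted vertex at most once, so it grows by at most 2ρ when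
-- D is expanded again; after i rounds the stretch is 2ρ(i + 1), and ⌊log₂ n⌋ rounds suffice.
--
-- No recursion over components is computed: each edge of G decides on its own whether it belongs
-- to the i-th tree, by following the contraction in which it survives.

open import Defs
open import Data.Bool using (Bool; true; false; _∧_; _∨_; not; if_then_else_)
import Data.Bool.Properties as Bool
open import Data.Empty using (⊥; ⊥-elim)
open import Data.Fin using (Fin; zero; suc; toℕ; fromℕ; fromℕ<; _≟_)
import Data.Fin.Properties as Fin
open import Data.Fin.Subset using () renaming (_∈_ to _∈ₛ_)
open import Data.List using (List; []; _∷_; length; map; foldl; foldr; tabulate; replicate; reverse; drop; allFin;
  applyUpTo; applyDownFrom; null)
open import Data.List.Membership.DecPropositional using () renaming (_∈?_ to dec-∈)
open import Data.List.Membership.Propositional using (_∈_)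
import Data.List.Properties as List
open import Data.List.Relation.Unary.All as All using (All; []; _∷_)
import Data.List.Relation.Unary.All.Properties as All
open import Data.List.Relation.Unary.AllPairs using ([]; _∷_)
open import Data.List.Relation.Unary.Any using (here; there)
import Data.List.Relation.Unary.Any.Properties as Any
open import Data.List.Relation.Unary.Unique.Propositional using (Unique)
open import Data.Nat using (ℕ; zero; suc; pred; _+_; _*_; _∸_; _^_; _≤_; _<_; z≤n; s≤s; s≤s⁻¹; ⌊_/2⌋; ⌈_/2⌉;
  NonZero; >-nonZero⁻¹)
open import Data.Nat.GeneralisedArithmetic using (fold)
open import Data.Nat.Induction using (<-rec)
open import Data.Nat.Logarithm using (⌊log₂_⌋; ⌊log₂⌋-mono-≤; ⌊log₂[2^n]⌋≡n; ⌊log₂⌊n/2⌋⌋≡⌊log₂n⌋∸1)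
import Data.Nat.Properties as ℕ
open import Data.Nat.Tactic.RingSolver using (solve-∀)
open import Data.Product using (Σ; ∃-syntax; _×_; _,_; proj₁; proj₂)
open import Data.Sum using (_⊎_; inj₁; inj₂; swap)
open import Data.Unit using (⊤; tt)
open import Algebra.Properties.CommutativeSemigroup ℕ.+-commutativeSemigroup using (interchange)
open import Function using (_∘_; id; flip)
open import Relation.Binary.Construct.Closure.ReflexiveTransitive as Star using (Star; ε; _◅_; _◅◅_)
open import Relation.Binary.PropositionalEquality using (_≡_; _≢_; refl; sym; trans; cong; cong₂; subst; subst₂)
open import Relation.Nullary using (¬_; Dec; yes; no; does; contradiction)
open import Relation.Nullary.Decidable using (map′; _×-dec_)

-- Why a balanced disk survives contraction: if the ball around no bag were balanced, each node of
-- the decomposition tree would point into the branch holding the heavy region off its ball. Two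
-- heavy regions meet, so adjacent nodes never point at each other, and a finite tree admits no such
-- choice. Contraction only shortens distances, so each bag still lies in a ball of radius ρ; and
-- since the contracted sets are connected in G, a region of the contracted graph is connected in G
-- off the ball, as the argument requires. The set W is carried along because the contracted graph
-- keeps an extra vertex for everything outside the region, while W counts only vertices never
-- contracted away. Contractions are labellings of the fixed vertex set, so all states share one
-- type. Neither ρ nor a tree-decomposition is given to the algorithm: it searches for the least
-- radius that works. Polynomial time is a property of the term language in which the algorithm is
-- restated, each of whose loops makes at most n turns.

private variable
  n : ℕ
  a b : Bool

-- Boolean connectives and Boolean-valued subsets

∧-elim : a ∧ b ≡ true → a ≡ true × b ≡ true
∧-elim {true} p = refl , p

∧-intro : a ≡ true → b ≡ true → a ∧ b ≡ true
∧-intro refl refl = refl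

∨-elim : a ∨ b ≡ true → a ≡ true ⊎ b ≡ true
∨-elim {true}  p = inj₁ refl
∨-elim {false} p = inj₂ p

∨-introˡ : a ≡ true → a ∨ b ≡ true
∨-introˡ refl = refl

∨-introʳ : b ≡ true → a ∨ b ≡ true
∨-introʳ {a = true}  p = refl
∨-introʳ {a = false} p = p

not-elim : not a ≡ true → ¬ (a ≡ true)
not-elim {false} p ()

not-intro : ¬ (a ≡ true) → not a ≡ true
not-intro {false} p = refl
not-intro {true}  p = contradiction refl p

infix 4 _∈ᵇ_ _∉ᵇ_ _⊆ᵇ_

_∈ᵇ_ _∉ᵇ_ : Fin n → (Fin n → Bool) → Set
x ∈ᵇ S = S x ≡ true
x ∉ᵇ S = ¬ (x ∈ᵇ S)

_⊆ᵇ_ : (S S′ : Fin n → Bool) → Set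
S ⊆ᵇ S′ = ∀ x → x ∈ᵇ S → x ∈ᵇ S′

_∈ᵇ?_ : (x : Fin n) (S : Fin n → Bool) → Dec (x ∈ᵇ S)
x ∈ᵇ? S = S x Bool.≟ true

infix 5 _≡ᵇ_

opaque
  _≡ᵇ_ : Fin n → Fin n → Bool
  i ≡ᵇ j = does (i ≟ j)

  ≡ᵇ-sound : {i j : Fin n} → (i ≡ᵇ j) ≡ true → i ≡ j
  ≡ᵇ-sound {i = i} {j} p with i ≟ j
  ... | yes i≡j = i≡j

  ≡ᵇ-complete : {i j : Fin n} → i ≡ j → (i ≡ᵇ j) ≡ true
  ≡ᵇ-complete {i = i} refl with i ≟ i
  ... | yes _   = refl
  ... | no  i≢i = contradiction refl i≢i

-- Folds, search and counting over a finite index set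

foldFin : {B : Set} → (Fin n → B → B) → B → B
foldFin {n = zero}  f b = b
foldFin {n = suc _} f b = f zero (foldFin (f ∘ suc) b)

foldFin-const : {B : Set} (f : B → B) (b : B) → foldFin {n} (λ _ → f) b ≡ fold b f n
foldFin-const {n = zero}  f b = refl
foldFin-const {n = suc n} f b = cong f (foldFin-const {n} f b)

opaque
  -- Written with `foldFin`, as are `find`, `closure` and `heavy`, so that a `folding` term
  -- evaluates to it.
  any : (Fin n → Bool) → Bool
  any p = foldFin (λ i b → p i ∨ b) false

  any-intro : (p : Fin n → Bool) (i : Fin n) → i ∈ᵇ p → any p ≡ true
  any-intro p zero    h = ∨-introˡ h
  any-intro p (suc i) h = ∨-introʳ {a = p zero} (any-intro (p ∘ suc) i h)

  any-elim : (p : Fin n → Bool) → any p ≡ true → ∃[ i ] i ∈ᵇ p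
  any-elim {n = suc _} p h with ∨-elim {p zero} h
  ... | inj₁ h₀ = zero , h₀
  ... | inj₂ h′ with any-elim (p ∘ suc) h′
  ...   | i , hᵢ = suc i , hᵢ

private
  findOr : {A : Set} → (Fin n → Bool) → (Fin n → A) → A → A
  findOr p f z = foldFin (λ i b → if p i then f i else b) z

  findOr-sound : {A : Set} (p : Fin n → Bool) (f : Fin n → A) (z : A) (i : Fin n) → i ∈ᵇ p →
                 ∃[ j ] j ∈ᵇ p × findOr p f z ≡ f j × toℕ j ≤ toℕ i
  findOr-sound p f z zero h rewrite h = zero , h , refl , z≤n
  findOr-sound p f z (suc i) h with p zero in eq
  ... | true  = zero , eq , refl , z≤n
  ... | false with findOr-sound (p ∘ suc) (f ∘ suc) z i h
  ...   | j , hⱼ , e , j≤i = suc j , hⱼ , e , s≤s j≤i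

  findOr-cong : {A : Set} (p p′ : Fin n → Bool) (f : Fin n → A) (z : A) →
                (∀ i → p i ≡ p′ i) → findOr p f z ≡ findOr p′ f z
  findOr-cong {n = zero}  p p′ f z h = refl
  findOr-cong {n = suc _} p p′ f z h
    rewrite h zero | findOr-cong (p ∘ suc) (p′ ∘ suc) (f ∘ suc) z (h ∘ suc) = refl

opaque
  find : (Fin (suc n) → Bool) → Fin (suc n)
  -- `zero` is the answer for an empty `p`; every use that relies on the result supplies a witness.
  find p = foldFin (λ i b → if p i then i else b) zero

  find-sound : (p : Fin (suc n) → Bool) {i : Fin (suc n)} → i ∈ᵇ p → find p ∈ᵇ p
  find-sound p {i} h with findOr-sound p (λ j → j) zero i h
  ... | j , hⱼ , e , _ = trans (cong p e) hⱼ

  find-least : (p : Fin (suc n) → Bool) {i : Fin (suc n)} → i ∈ᵇ p → toℕ (find p) ≤ toℕ i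
  find-least p {i} h with findOr-sound p (λ j → j) zero i h
  ... | j , hⱼ , e , j≤i = subst (λ k → toℕ k ≤ toℕ i) (sym e) j≤i

  find-cong : (p p′ : Fin (suc n) → Bool) → (∀ i → p i ≡ p′ i) → find p ≡ find p′
  find-cong p p′ = findOr-cong p p′ (λ j → j) zero

≡-from-⇔ : (a ≡ true → b ≡ true) → (b ≡ true → a ≡ true) → a ≡ b
≡-from-⇔ {true}  {b} f g = sym (f refl)
≡-from-⇔ {false} {true} f g = g refl
≡-from-⇔ {false} {false} f g = refl

opaque
  unfolding _≡ᵇ_

  count : (Fin n → Bool) → ℕ
  count p = foldFin (λ i k → if p i then suc k else k) 0

  count-mono : (p p′ : Fin n → Bool) → p ⊆ᵇ p′ → count p ≤ count p′
  count-mono {n = zero}  p p′ h = z≤n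
  count-mono {n = suc _} p p′ h with p zero in e | p′ zero in e′ | count-mono (p ∘ suc) (p′ ∘ suc) (h ∘ suc)
  ... | true  | true  | r = s≤s r
  ... | true  | false | r with trans (sym e′) (h zero e)
  ...   | ()
  count-mono {n = suc _} p p′ h | false | true | r = ℕ.m≤n⇒m≤1+n r
  count-mono {n = suc _} p p′ h | false | false | r = r

  count-strict : (p p′ : Fin n → Bool) → p ⊆ᵇ p′ → (i : Fin n) → i ∈ᵇ p′ → i ∉ᵇ p → count p < count p′
  count-strict {n = suc _} p p′ h zero i∈ i∉ with p zero
  ... | true  = contradiction refl i∉
  ... | false rewrite i∈ = s≤s (count-mono (p ∘ suc) (p′ ∘ suc) (h ∘ suc))
  count-strict {n = suc _} p p′ h (suc i) i∈ i∉
    with p zero in e | p′ zero in e′ | count-strict (p ∘ suc) (p′ ∘ suc) (h ∘ suc) i i∈ i∉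
  ... | true  | true  | r = s≤s r
  ... | true  | false | r with trans (sym e′) (h zero e)
  ...   | ()
  count-strict {n = suc _} p p′ h (suc i) i∈ i∉ | false | true | r = ℕ.m≤n⇒m≤1+n r
  count-strict {n = suc _} p p′ h (suc i) i∈ i∉ | false | false | r = r

  count-true : ∀ n → count {n} (λ _ → true) ≡ n
  count-true zero    = refl
  count-true (suc n) = cong suc (count-true n)

  count-false : ∀ n → count {n} (λ _ → false) ≡ 0
  count-false zero    = refl
  count-false (suc n) = count-false n

  count-full : (p : Fin n → Bool) → n ≤ count p → ∀ i → i ∈ᵇ p
  count-full {n} p n≤ i with i ∈ᵇ? p
  ... | yes i∈ = i∈
  ... | no  i∉ = contradiction (subst (count p <_) (count-true n) (count-strict p _ (λ _ _ → refl) i refl i∉))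
                               (ℕ.≤⇒≯ n≤)

  count-cong : (p p′ : Fin n → Bool) → (∀ i → p i ≡ p′ i) → count p ≡ count p′
  count-cong {n = zero}  p p′ h = refl
  count-cong {n = suc _} p p′ h rewrite h zero | count-cong (p ∘ suc) (p′ ∘ suc) (h ∘ suc) = refl

  count-positive : (p : Fin n → Bool) {i : Fin n} → i ∈ᵇ p → 0 < count p
  count-positive {n} p {i} i∈ = subst (_< count p) (count-false n)
                                (count-strict (λ _ → false) p (λ _ ()) i i∈ (λ ()))

  positive-count : (p : Fin n → Bool) → 0 < count p → ∃[ i ] i ∈ᵇ p
  positive-count {n} p h with any p in e
  ... | true  = any-elim p e
  ... | false = contradiction (subst (0 <_) (trans (count-cong p _ none) (count-false n)) h) λ ()
    where
    none : ∀ i → p i ≡ false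
    none i with p i in eᵢ
    ... | false = refl
    ... | true with trans (sym e) (any-intro p i eᵢ)
    ...   | ()

  count-split : (p k : Fin n → Bool) →
                count (λ i → p i ∧ k i) + count (λ i → p i ∧ not (k i)) ≡ count p
  count-split {n = zero}  p k = refl
  count-split {n = suc _} p k with p zero | k zero
  ... | true  | true  = cong suc (count-split (p ∘ suc) (k ∘ suc))
  ... | true  | false = trans (ℕ.+-suc _ _) (cong suc (count-split (p ∘ suc) (k ∘ suc)))
  ... | false | _     = count-split (p ∘ suc) (k ∘ suc)

  count-single : (p : Fin n → Bool) (i : Fin n) → i ∈ᵇ p → count (λ j → p j ∧ (j ≡ᵇ i)) ≡ 1
  count-single {n = suc n} p zero h rewrite h =
    cong suc (trans (count-cong _ (λ _ → false) (λ j → Bool.∧-zeroʳ (p (suc j)))) (count-false n))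
  count-single {n = suc n} p (suc i) h with p zero
  ... | true  = trans (count-cong _ _ shift) (count-single (p ∘ suc) i h)
    where
    shift : ∀ j → (p (suc j) ∧ (suc j ≡ᵇ suc i)) ≡ (p (suc j) ∧ (j ≡ᵇ i))
    shift j = cong (p (suc j) ∧_) refl
  ... | false = count-single (p ∘ suc) i h

  count-delete : (p : Fin n → Bool) (i : Fin n) → i ∈ᵇ p →
                 suc (count (λ j → p j ∧ not (j ≡ᵇ i))) ≡ count p
  count-delete p i h = trans (cong (_+ count (λ j → p j ∧ not (j ≡ᵇ i))) (sym (count-single p i h)))
                             (count-split p (_≡ᵇ i))

-- Growing a set along a relation

Holds : (Fin n → Fin n → Bool) → Fin n → Fin n → Set
Holds R x y = R x y ≡ true

Closed : (Fin n → Fin n → Bool) → (Fin n → Bool) → Set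
Closed R S = ∀ x y → x ∈ᵇ S → Holds R x y → y ∈ᵇ S

opaque
  grow : (Fin n → Fin n → Bool) → (Fin n → Bool) → Fin n → Bool
  grow R S x = S x ∨ any (λ y → S y ∧ R y x)

  spread : (Fin n → Fin n → Bool) → (Fin n → Bool) → ℕ → Fin n → Bool
  spread R S = fold S (grow R)

  -- The rounds are counted by a fold that ignores its index: n rounds always suffice, and this
  -- bound is available as a loop in the term language.
  closure : (Fin n → Fin n → Bool) → (Fin n → Bool) → Fin n → Bool
  closure {n} R S = foldFin {n} (λ _ → grow R) S

module _ {n} (R : Fin n → Fin n → Bool) (S : Fin n → Bool) where

  opaque
    unfolding spread

    closure-spread : ∀ x → closure R S x ≡ spread R S n x
    closure-spread x = cong (λ S → S x) (foldFin-const {n} (grow R) S)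

    spread-zero : ∀ x → spread R S 0 x ≡ S x
    spread-zero x = refl

    spread-⊆ : ∀ k → spread R S k ⊆ᵇ spread R S (suc k)
    spread-⊆ k x = ∨-introˡ

    spread-step : ∀ k {x y} → x ∈ᵇ spread R S k → Holds R x y → y ∈ᵇ spread R S (suc k)
    spread-step k {x} {y} x∈ r = ∨-introʳ {a = spread R S k y} (any-intro _ x (∧-intro x∈ r))

    spread-elim : ∀ k {y} → y ∈ᵇ spread R S (suc k) →
                  y ∈ᵇ spread R S k ⊎ ∃[ x ] x ∈ᵇ spread R S k × Holds R x y
    spread-elim k {y} h with ∨-elim {spread R S k y} h
    ... | inj₁ y∈ = inj₁ y∈
    ... | inj₂ h′ with any-elim _ h′
    ...   | x , hₓ = inj₂ (x , ∧-elim {spread R S k x} hₓ)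

  spread-mono : ∀ {j k} → j ≤ k → spread R S j ⊆ᵇ spread R S k
  spread-mono {_} {zero}  z≤n x h = h
  spread-mono {j} {suc k} j≤  x h with ℕ.m≤n⇒m<n∨m≡n j≤
  ... | inj₁ (s≤s j≤k) = spread-⊆ k x (spread-mono j≤k x h)
  ... | inj₂ refl      = h

  spread-sound : ∀ k {x} → x ∈ᵇ spread R S k → ∃[ s ] s ∈ᵇ S × Star (Holds R) s x
  spread-sound zero    h = _ , trans (sym (spread-zero _)) h , ε
  spread-sound (suc k) h with spread-elim k h
  ... | inj₁ x∈ = spread-sound k x∈
  ... | inj₂ (y , y∈ , r) with spread-sound k y∈
  ...   | s , s∈ , w = s , s∈ , w ◅◅ (r ◅ ε)

  -- A round either adds an element, raising the count by one, or changes nothing, and then the set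
  -- is closed from that round on.
  closed-or-large : ∀ k → Closed R (spread R S k) ⊎ k + count S ≤ count (spread R S k)
  closed-or-large zero = inj₂ (ℕ.≤-reflexive (count-cong _ _ λ x → sym (spread-zero x)))
  closed-or-large (suc k) with closed-or-large k
  ... | inj₁ cl = inj₁ λ x y x∈ r → spread-⊆ k y (cl x y (back (spread-elim k x∈)) r)
    where
    back : ∀ {x} → x ∈ᵇ spread R S k ⊎ ∃[ z ] z ∈ᵇ spread R S k × Holds R z x → x ∈ᵇ spread R S k
    back (inj₁ x∈)           = x∈
    back (inj₂ (z , z∈ , r)) = cl z _ z∈ r
  ... | inj₂ large with any (λ x → spread R S (suc k) x ∧ not (spread R S k x)) in e
  ...   | true with any-elim _ e
  ...     | x , hₓ with ∧-elim {spread R S (suc k) x} hₓ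
  ...       | x∈ , x∉ = inj₂ (ℕ.≤-trans (s≤s large)
              (count-strict (spread R S k) (spread R S (suc k)) (spread-⊆ k) x x∈ (not-elim x∉)))
  closed-or-large (suc k) | inj₂ large | false =
    inj₁ λ x y x∈ r → spread-⊆ k y (back y (spread-step k (back x x∈) r))
    where
    back : spread R S (suc k) ⊆ᵇ spread R S k
    back x x∈ with x ∈ᵇ? spread R S k
    ... | yes p = p
    ... | no  p with trans (sym e) (any-intro _ x (∧-intro x∈ (not-intro p)))
    ...   | ()

  spread-closed : ∀ k → n ≤ k + count S → Closed R (spread R S k)
  spread-closed k n≤ with closed-or-large k
  ... | inj₁ cl    = cl
  ... | inj₂ large = λ _ y _ _ → count-full (spread R S k) (ℕ.≤-trans n≤ large) y

  closure-⊇ : S ⊆ᵇ closure R S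
  closure-⊇ x x∈ = trans (closure-spread x) (spread-mono z≤n x (trans (spread-zero x) x∈))

  closure-closed : Closed R (closure R S)
  closure-closed x y x∈ r = trans (closure-spread y)
    (spread-closed n (ℕ.m≤m+n n _) x y (trans (sym (closure-spread x)) x∈) r)

  closure-sound : ∀ {x} → x ∈ᵇ closure R S → ∃[ s ] s ∈ᵇ S × Star (Holds R) s x
  closure-sound {x} x∈ = spread-sound n (trans (sym (closure-spread x)) x∈)

-- Comparing cardinalities without arithmetic

dropFirst : (Fin (suc n) → Bool) → Fin (suc n) → Bool
dropFirst S x = S x ∧ not (x ≡ᵇ find S)

-- More than half of W lies in K: removing an element of W ∩ K for every element of W ∖ K
-- leaves something over.
heavy : (Fin (suc n) → Bool) → (Fin (suc n) → Bool) → Bool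
heavy W K = any (foldFin (λ i S → if W i ∧ not (K i) then dropFirst S else S) (λ i → W i ∧ K i))

count-dropFirst : ∀ {m} (S : Fin (suc m) → Bool) → count (dropFirst S) ≡ pred (count S)
count-dropFirst S with count S in eq
... | suc k = ℕ.suc-injective (trans (count-delete S (find S) (find-sound S (proj₂ some))) eq)
  where
  some = positive-count S (subst (0 <_) (sym eq) (s≤s z≤n))
... | zero = ℕ.n≤0⇒n≡0 (subst (count (dropFirst S) ≤_) eq (count-mono (dropFirst S) S λ x h → proj₁ (∧-elim {S x} h)))

opaque
  unfolding count

  -- Removal from the empty set does nothing, which is why the subtraction is truncated.
  count-dropMany : ∀ {m n} (p : Fin n → Bool) (S : Fin (suc m) → Bool) →
    count (foldFin (λ i S → if p i then dropFirst S else S) S) ≡ count S ∸ count p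
  count-dropMany {n = zero}  p S = refl
  count-dropMany {n = suc n} p S with p zero
  ... | true = trans (count-dropFirst (foldFin (λ i S → if p (suc i) then dropFirst S else S) S)) (trans (cong pred (count-dropMany (p ∘ suc) S))
                 (ℕ.pred[m∸n]≡m∸[1+n] (count S) (count (p ∘ suc))))
  ... | false = count-dropMany (p ∘ suc) S

heavy-sound : ∀ {m} (W K : Fin (suc m) → Bool) → heavy W K ≡ true →
              count (λ i → W i ∧ not (K i)) < count (λ i → W i ∧ K i)
heavy-sound W K h = ℕ.m∸n≢0⇒n<m λ eq → contradiction
  (subst (0 <_) (trans (count-dropMany (λ i → W i ∧ not (K i)) _) eq)
    (count-positive _ (proj₂ (any-elim _ h)))) λ ()

heavy-complete : ∀ {m} (W K : Fin (suc m) → Bool) → count (λ i → W i ∧ not (K i)) < count (λ i → W i ∧ K i) → heavy W K ≡ true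
heavy-complete W K lt = any-intro _ _ (proj₂ (positive-count _
  (subst (0 <_) (sym (count-dropMany (λ i → W i ∧ not (K i)) _)) (ℕ.m<n⇒0<n∸m lt))))

-- The algorithm, as functions of a Boolean adjacency matrix

module Algorithm {m : ℕ} (adj : Fin (suc m) → Fin (suc m) → Bool) where

  V : Set
  V = Fin (suc m)

  -- A contraction of G, given by a labelling whose fibres are the contracted sets, and the set W.
  State : Set
  State = (V → V) × (V → Bool)

  link : (V → V) → V → V → Bool
  link q y x = any λ z → adj y z ∧ (q z ≡ᵇ q x)

  -- Distances are those of the contracted graph: moving within a fibre is free.
  ball : (V → V) → V → ℕ → V → Bool
  ball q v k = spread (link q) (λ x → q v ≡ᵇ q x) k

  -- Only the target is tested against `D`: wherever the resulting component matters, its starting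
  -- vertex is off the disk already.
  bond : (V → V) → (V → Bool) → V → V → Bool
  bond q D y x = not (D x) ∧ (adj y x ∨ (q y ≡ᵇ q x))

  component : (V → V) → (V → Bool) → V → V → Bool
  component q D u = closure (bond q D) (λ x → u ≡ᵇ x)

  balanced : State → V → V → Bool
  balanced (q , W) v r =
    not (any λ u → not (ball q v (toℕ r) u) ∧ heavy W (component q (ball q v (toℕ r)) u))

  opaque
    -- A search stands in for ρ, which is not an input; the least radius is at most any radius for
    -- which a balanced disk is known to exist.
    radius : State → V
    radius s = find λ r → any λ v → balanced s v r

    center : State → V
    center s = find λ v → balanced s v (radius s)

  disk : State → V → Bool
  disk s = ball (proj₁ s) (center s) (toℕ (radius s))

  region : State → V → V → Bool
  region s = component (proj₁ s) (disk s)

  leader : State → V → V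
  leader s u = find (region s u)

  -- The leader depends on the region only, hence so does the resulting state.
  focus : State → V → State
  focus s u = (λ x → if region s (leader s u) x then proj₁ s x else proj₁ s (center s))
            , (λ x → proj₂ s x ∧ region s (leader s u) x)

  -- An edge inside the disk keeps its state for all later rounds, so its fate is decided there.
  descend : V → V → State → State
  descend u v s = if disk s u ∧ disk s v then s else focus s (if disk s u then v else u)

  -- A canonical representative through which the class of `z` is entered from the ball. It depends
  -- on `z` only through its label, so all members of a class agree on it.
  entry : (V → V) → V → ℕ → V → V
  entry q v k z = find λ z′ → (q z′ ≡ᵇ q z) ∧ any λ y′ → ball q v k y′ ∧ adj y′ z′

  opaque
    -- Many edges of G may enter a class from the previous layer. The two equations select the first
    -- entry vertex and then its first neighbour in the ball, leaving a single edge of G per class;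
    -- here `k` is the layer of `y`.
    parent : (V → V) → V → V → V → Bool
    parent q v y z = adj y z ∧ any λ (k : V) → ball q v (toℕ k) y ∧ not (ball q v (toℕ k) z) ∧
      (z ≡ᵇ entry q v (toℕ k) z) ∧ (y ≡ᵇ find λ y′ → ball q v (toℕ k) y′ ∧ adj y′ z)

    bfs : State → V → V → Bool
    bfs s y z = parent (proj₁ s) (center s) y z ∨ parent (proj₁ s) (center s) z y

  initial : State
  initial = (λ x → x) , (λ _ → true)

  opaque
    forest : ℕ → State → V → V → Bool
    forest i s u v = adj u v ∧ bfs (fold s (descend u v) i) u v

  spanner : ℕ → V → V → Bool
  spanner i = forest i initial

last-true : ∀ {n} (p : Fin n → Bool) (i : Fin n) → i ∈ᵇ p → ∃[ j ] j ∈ᵇ p × (∀ k → k ∈ᵇ p → toℕ k ≤ toℕ j)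
last-true {suc n} p i h with any (p ∘ suc) in e
... | true with any-elim (p ∘ suc) e
...   | i′ , h′ with last-true (p ∘ suc) i′ h′
...     | j , hⱼ , max = suc j , hⱼ , λ { zero _ → z≤n ; (suc k) hₖ → s≤s (max k hₖ) }
last-true {suc n} p zero h | false = zero , h ,
  λ { zero _ → z≤n ; (suc k) hₖ → contradiction (trans (sym e) (any-intro (p ∘ suc) k hₖ)) λ () }
last-true {suc n} p (suc i) h | false = contradiction (trans (sym e) (any-intro (p ∘ suc) i h)) λ ()

-- Edge sets and paths modulo a labelling

module _ {n : ℕ} where

  -- The existence of a crossing edge in every nonempty S ⊆ E makes E acyclic, and, unlike
  -- acyclicity, is inherited from a contraction of one part of the graph.
  Independent : (Fin n → Fin n) → (Fin n → Fin n → Bool) → Set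
  Independent q E =
    (S : Fin n → Fin n → Bool) → (∀ x y → Holds S x y → Holds E x y) → ∀ x y → Holds S x y →
    Σ (Fin n → Bool) λ f → (∀ x y → q x ≡ q y → f x ≡ f y) ×
    ∃[ a ] ∃[ b ] (Holds S a b × f a ≢ f b ×
      (∀ x y → Holds S x y → f x ≢ f y → (x ≡ a × y ≡ b) ⊎ (x ≡ b × y ≡ a)))

  infixr 5 _∷⟨_⟩_
  -- Walks of the quotient graph without a quotient type: jumps between members of a fibre are free
  -- and only edges of `E` are counted. For `q = id` these are ordinary walks.
  data Path (q : Fin n → Fin n) (E : Fin n → Fin n → Bool) : Fin n → Fin n → ℕ → Set where
    stop : ∀ {x y} → q x ≡ q y → Path q E x y 0
    _∷⟨_⟩_ : ∀ {x x′ y z k} → q x ≡ q x′ → Holds E x′ y → Path q E y z k → Path q E x z (suc k)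

  module _ {q : Fin n → Fin n} {E : Fin n → Fin n → Bool} where

    slide : ∀ {x x′ y k} → q x ≡ q x′ → Path q E x′ y k → Path q E x y k
    slide e (stop e′)      = stop (trans e e′)
    slide e (e′ ∷⟨ h ⟩ p) = trans e e′ ∷⟨ h ⟩ p

    _++ₚ_ : ∀ {x y z j k} → Path q E x y j → Path q E y z k → Path q E x z (j + k)
    stop e        ++ₚ p′ = slide e p′
    (e ∷⟨ h ⟩ p) ++ₚ p′ = e ∷⟨ h ⟩ (p ++ₚ p′)

    reverseₚ : (∀ x y → Holds E x y → Holds E y x) → ∀ {x y k} → Path q E x y k → Path q E y x k
    reverseₚ E-sym (stop e) = stop (sym e)
    reverseₚ E-sym (_∷⟨_⟩_ {k = k} e h p) =
      subst (Path q E _ _) (ℕ.+-comm k 1)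
        (reverseₚ E-sym p ++ₚ (refl ∷⟨ E-sym _ _ h ⟩ stop (sym e)))

  Path-map : ∀ {q q′ E E′} → (∀ x y → q x ≡ q y → q′ x ≡ q′ y) → (∀ x y → Holds E x y → Holds E′ x y) →
             ∀ {x y k} → Path q E x y k → Path q′ E′ x y k
  Path-map f g (stop e)      = stop (f _ _ e)
  Path-map f g (e ∷⟨ h ⟩ p) = f _ _ e ∷⟨ g _ _ h ⟩ Path-map f g p

-- Balls and breadth-first trees of a contracted graph

module Contraction {m : ℕ} (G : Graph (suc m)) (joined : ∀ u v → Walk G u v) where

  open Algorithm (adj G) public

  adj-sym : ∀ x y → Edge G x y → Edge G y x
  adj-sym x y e = trans (sym (Graph.symmetric G x y)) e

  Inside : (V → Set) → V → V → Set
  Inside P x y = Edge G x y × P x × P y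

  inside-sym : ∀ {P : V → Set} {x y} → Star (Inside P) x y → Star (Inside P) y x
  inside-sym = Star.reverse λ (e , p , p′) → adj-sym _ _ e , p′ , p

  Inside-map : ∀ {P P′ : V → Set} → (∀ x → P x → P′ x) → ∀ {x y} → Star (Inside P) x y → Star (Inside P′) x y
  Inside-map f = Star.map λ (e , p , p′) → e , f _ p , f _ p′

  -- The invariant that makes a labelling a contraction: a jump inside a fibre can be replaced by a
  -- walk of G in that fibre.
  ConnectedClasses : (V → V) → Set
  ConnectedClasses q = ∀ x y → q x ≡ q y → Star (Inside λ z → q z ≡ q x) x y

  module Balls (q : V → V) (v : V) where

    B₀ : V → Bool
    B₀ x = q v ≡ᵇ q x

    B : ℕ → V → Bool
    B = ball q v

    B-mono : ∀ {j k} → j ≤ k → B j ⊆ᵇ B k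
    B-mono = spread-mono (link q) B₀

    B-zero-intro : ∀ {x} → q v ≡ q x → x ∈ᵇ B 0
    B-zero-intro {x} eq = trans (spread-zero (link q) B₀ x) (≡ᵇ-complete eq)

    B-zero-elim : ∀ {x} → x ∈ᵇ B 0 → q v ≡ q x
    B-zero-elim {x} x∈ = ≡ᵇ-sound (trans (sym (spread-zero (link q) B₀ x)) x∈)

    center∈B : ∀ k → v ∈ᵇ B k
    center∈B k = B-mono {0} z≤n v (B-zero-intro refl)

    B-step : ∀ k {y z x} → y ∈ᵇ B k → Edge G y z → q z ≡ q x → x ∈ᵇ B (suc k)
    B-step k {z = z} y∈ e eq =
      spread-step (link q) B₀ k y∈ (any-intro _ z (∧-intro e (≡ᵇ-complete eq)))

    B-elim : ∀ k {x} → x ∈ᵇ B (suc k) → x ∈ᵇ B k ⊎ ∃[ y ] ∃[ z ] (y ∈ᵇ B k × Edge G y z × q z ≡ q x)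
    B-elim k h with spread-elim (link q) B₀ k h
    ... | inj₁ x∈ = inj₁ x∈
    ... | inj₂ (y , y∈ , l) with any-elim _ l
    ...   | z , h′ with ∧-elim {adj G y z} h′
    ...     | e , eq = inj₂ (y , z , y∈ , e , ≡ᵇ-sound eq)

    B-class : ∀ k {x y} → q x ≡ q y → x ∈ᵇ B k → y ∈ᵇ B k
    B-class zero    eq x∈ = B-zero-intro (trans (B-zero-elim x∈) eq)
    B-class (suc k) eq x∈ with B-elim k x∈
    ... | inj₁ x∈′ = B-mono (ℕ.n≤1+n k) _ (B-class k eq x∈′)
    ... | inj₂ (y , z , y∈ , e , eq′) = B-step k y∈ e (trans eq′ eq)

    B-full : ∀ x → x ∈ᵇ B m
    B-full x = go (joined v x) (center∈B m)
      where
      closed : Closed (link q) (B m)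
      -- The initial set contains `v`, so m rounds are enough among m + 1 vertices.
      closed = spread-closed (link q) B₀ m
        (subst (_≤ m + count B₀) (ℕ.+-comm m 1) (ℕ.+-monoʳ-≤ m (count-positive B₀ {v} (≡ᵇ-complete refl))))
      go : ∀ {y} → Walk G y x → y ∈ᵇ B m → x ∈ᵇ B m
      go ε       y∈ = y∈
      go (_◅_ {j = z} e w) y∈ = go w (closed _ z y∈ (any-intro _ z (∧-intro e (≡ᵇ-complete {i = q z} refl))))

    path⇒∈B : ∀ {E} → (∀ x y → Holds E x y → Edge G x y) → ∀ j {x y k} → x ∈ᵇ B j → Path q E x y k → y ∈ᵇ B (k + j)
    path⇒∈B E⊆ j x∈ (stop e) = B-class j e x∈
    path⇒∈B E⊆ j {y = y} x∈ (_∷⟨_⟩_ {k = k} e h p) =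
      subst (λ i → y ∈ᵇ B i) (ℕ.+-suc k j)
        (path⇒∈B E⊆ (suc j) (B-step j (B-class j e x∈) (E⊆ _ _ h) refl) p)

    -- The disk becomes part of one fibre of the next state, and fibres have to be connected in G
    -- itself.
    B-connected : ConnectedClasses q → ∀ k x → x ∈ᵇ B k → Star (Inside (_∈ᵇ B k)) x v
    B-connected conn zero x x∈ =
      inside-sym (Inside-map (λ z e → B-zero-intro (sym e)) (conn v x (B-zero-elim x∈)))
    B-connected conn (suc k) x x∈ with B-elim k x∈
    ... | inj₁ x∈′ = Inside-map (B-mono (ℕ.n≤1+n k)) (B-connected conn k x x∈′)
    ... | inj₂ (y , z , y∈ , e , eq) =
      Inside-map (λ w e′ → B-step k y∈ e (trans eq (sym e′))) (conn x z (sym eq))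
      ◅◅ (adj-sym _ _ e , B-step k y∈ e refl , B-mono (ℕ.n≤1+n k) y y∈)
      ◅ Inside-map (B-mono (ℕ.n≤1+n k)) (B-connected conn k y y∈)

    record IsParent (k : V) (y z : V) : Set where
      constructor isParent
      field
        edge    : Edge G y z
        below   : y ∈ᵇ B (toℕ k)
        above   : z ∉ᵇ B (toℕ k)
        z-first : z ≡ entry q v (toℕ k) z
        y-first : y ≡ find (λ y′ → B (toℕ k) y′ ∧ adj G y′ z)

    opaque
      unfolding parent

      parent-elim : ∀ {y z} → Holds (parent q v) y z → ∃[ k ] IsParent k y z
      parent-elim {y} {z} h with ∧-elim {adj G y z} h
      ... | e , h₁ with any-elim _ h₁
      ...   | k , h₂ with ∧-elim {B (toℕ k) y} h₂
      ...     | y∈ , h₃ with ∧-elim {not (B (toℕ k) z)} h₃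
      ...       | z∉ , h₄ with ∧-elim {z ≡ᵇ entry q v (toℕ k) z} h₄
      ...         | ez , ey = k , isParent e y∈ (not-elim z∉) (≡ᵇ-sound ez) (≡ᵇ-sound ey)

      parent-intro : ∀ {k y z} → IsParent k y z → Holds (parent q v) y z
      parent-intro {k} (isParent e y∈ z∉ ez ey) =
        ∧-intro e (any-intro _ k (∧-intro y∈ (∧-intro (not-intro z∉) (∧-intro (≡ᵇ-complete ez) (≡ᵇ-complete ey)))))

    parent-exists : ∀ k {x} → x ∈ᵇ B (suc (toℕ k)) → x ∉ᵇ B (toℕ k) →
                    ∃[ y ] ∃[ z ] (IsParent k y z × q z ≡ q x)
    parent-exists k {x} x∈ x∉ with B-elim (toℕ k) x∈
    ... | inj₁ x∈′ = contradiction x∈′ x∉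
    ... | inj₂ (y , z , y∈ , e , eq) = y* , z* , isParent e* y*∈ z*∉ z*-first refl , z*~x
      where
      candidate : V → V → Bool
      candidate x z′ = (q z′ ≡ᵇ q x) ∧ any λ y′ → B (toℕ k) y′ ∧ adj G y′ z′
      z* y* : V
      z* = find (candidate x)
      y* = find λ y′ → B (toℕ k) y′ ∧ adj G y′ z*
      found : z* ∈ᵇ candidate x
      found = find-sound (candidate x) {z} (∧-intro (≡ᵇ-complete eq) (any-intro _ y (∧-intro y∈ e)))
      z*~x : q z* ≡ q x
      z*~x = ≡ᵇ-sound (proj₁ (∧-elim {q z* ≡ᵇ q x} found))
      some = any-elim _ (proj₂ (∧-elim {q z* ≡ᵇ q x} found))
      found′ = find-sound (λ y′ → B (toℕ k) y′ ∧ adj G y′ z*) {proj₁ some} (proj₂ some)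
      y*∈ = proj₁ (∧-elim {B (toℕ k) y*} found′)
      e*  = proj₂ (∧-elim {B (toℕ k) y*} found′)
      z*∉ : z* ∉ᵇ B (toℕ k)
      z*∉ z*∈ = x∉ (B-class (toℕ k) z*~x z*∈)
      z*-first : z* ≡ entry q v (toℕ k) z*
      -- `x` and `z*` carry the same label, so the search for the entry vertex is the same for both.
      z*-first = find-cong (candidate x) (candidate z*) λ i → cong (λ j → (q i ≡ᵇ j) ∧ any λ y′ → B (toℕ k) y′ ∧ adj G y′ i) (sym z*~x)

    -- Left open to any `E` that contains the parent edges within radius `r`: the breadth-first tree
    -- has them for `r = m`, a deeper forest is only known to have them inside its disk.
    toCenter : (E : V → V → Bool) (r : ℕ) → r ≤ m →
               (∀ y z → Holds (parent q v) y z → y ∈ᵇ B r → z ∈ᵇ B r → Holds E z y) →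
               ∀ k → k ≤ r → ∀ x → x ∈ᵇ B k → ∃[ j ] (j ≤ k × Path q E x v j)
    toCenter E r r≤m E⊇ zero    k≤r x x∈ = 0 , z≤n , stop (sym (B-zero-elim x∈))
    toCenter E r r≤m E⊇ (suc k) k<r x x∈ with x ∈ᵇ? B k
    ... | yes x∈′ with toCenter E r r≤m E⊇ k (ℕ.<⇒≤ k<r) x x∈′
    ...   | j , j≤k , p = j , ℕ.m≤n⇒m≤1+n j≤k , p
    toCenter E r r≤m E⊇ (suc k) k<r x x∈ | no x∉ = suc j , s≤s j≤k , sym z~x ∷⟨ E⊇ _ _ (parent-intro P) y∈r z∈r ⟩ p
      where
      k<n : k < suc m
      k<n = ℕ.m<n⇒m<1+n (ℕ.<-≤-trans k<r r≤m)
      k′ : V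
      k′ = fromℕ< k<n
      k≡ : toℕ k′ ≡ k
      k≡ = Fin.toℕ-fromℕ< k<n
      step = parent-exists k′ {x} (subst (λ i → x ∈ᵇ B (suc i)) (sym k≡) x∈) (λ h → x∉ (subst (λ i → x ∈ᵇ B i) k≡ h))
      y = proj₁ step
      P = proj₁ (proj₂ (proj₂ step))
      z~x = proj₂ (proj₂ (proj₂ step))
      y∈ : y ∈ᵇ B k
      y∈ = subst (λ i → y ∈ᵇ B i) k≡ (IsParent.below P)
      y∈r = B-mono (ℕ.<⇒≤ k<r) y y∈
      z∈r = B-mono k<r _ (B-class (suc k) (sym z~x) x∈)
      rest = toCenter E r r≤m E⊇ k (ℕ.<⇒≤ k<r) y y∈
      j = proj₁ rest
      j≤k = proj₁ (proj₂ rest)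
      p = proj₂ (proj₂ rest)

    -- The topmost edge of S separates the class it enters from everything else.
    bfs-independent : Independent q (λ y z → parent q v y z ∨ parent q v z y)
    bfs-independent S S⊆ x₀ y₀ s₀ = conclude (last-true occupied (proj₁ start) (proj₂ start))
      where
      oriented : V → V → Bool
      oriented y z = (S y z ∨ S z y) ∧ parent q v y z

      occupied : V → Bool
      occupied k = any λ y → any λ z → oriented y z ∧ (B (toℕ k) y ∧ not (B (toℕ k) z))

      occupied-intro : ∀ {k y z} → S y z ∨ S z y ≡ true → IsParent k y z → k ∈ᵇ occupied
      occupied-intro {k} {y} {z} s P = any-intro _ y (any-intro _ z
        (∧-intro (∧-intro s (parent-intro P)) (∧-intro (IsParent.below P) (not-intro (IsParent.above P)))))

      start : ∃[ k ] k ∈ᵇ occupied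
      start with ∨-elim {parent q v x₀ y₀} (S⊆ x₀ y₀ s₀)
      ... | inj₁ h = _ , occupied-intro (∨-introˡ s₀) (proj₂ (parent-elim h))
      ... | inj₂ h = _ , occupied-intro (∨-introʳ {a = S y₀ x₀} s₀) (proj₂ (parent-elim h))

      same-layer : ∀ {k k′ y z y′ z′} → IsParent k y z → IsParent k′ y′ z′ → q z′ ≡ q z → toℕ k ≤ toℕ k′
      same-layer {k} {k′} P P′ eq = ℕ.≮⇒≥ λ k′<k → IsParent.above P
        (B-mono k′<k _ (B-step (toℕ k′) (IsParent.below P′) (IsParent.edge P′) eq))

      conclude : ∃[ k ] k ∈ᵇ occupied × (∀ k′ → k′ ∈ᵇ occupied → toℕ k′ ≤ toℕ k) → _
      conclude (k₀ , k₀∈ , max) with any-elim _ k₀∈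
      ... | y , h₁ with any-elim _ h₁
      ...   | z , h₂ with ∧-elim {oriented y z} h₂
      ...     | h₃ , h₄ with ∧-elim {S y z ∨ S z y} h₃ | ∧-elim {B (toℕ k₀) y} h₄
      ...       | s , par | y∈ , z∉′ with parent-elim par
      ...         | k , P = f , f-resp , result (∨-elim {S y z} s)
        where
        open IsParent P
        z∉ : z ∉ᵇ B (toℕ k₀)
        z∉ = not-elim z∉′
        max′ : ∀ {k′ y′ z′} → S y′ z′ ∨ S z′ y′ ≡ true → IsParent k′ y′ z′ → toℕ k′ ≤ toℕ k
        -- `k` and `k₀` are separate witnesses for the same edge. As `z` is in the ball of radius
        -- `k + 1` but not in that of radius `k₀`, we have `k₀ ≤ k`.
        max′ s P′ = ℕ.≤-trans (max _ (occupied-intro s P′)) (ℕ.≮⇒≥ λ k<k₀ →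
          z∉ (B-mono k<k₀ z (B-step (toℕ k) below edge refl)))
        f : V → Bool
        f x = q x ≡ᵇ q z
        f-resp : ∀ x y → q x ≡ q y → f x ≡ f y
        f-resp x y eq = cong (_≡ᵇ q z) eq
        fz : f z ≡ true
        fz = ≡ᵇ-complete {i = q z} refl
        fy : f y ≢ true
        fy h = above (B-class (toℕ k) (≡ᵇ-sound h) below)
        unique : ∀ {y′ z′} → S y′ z′ ∨ S z′ y′ ≡ true → Holds (parent q v) y′ z′ → f y′ ≢ f z′ → y′ ≡ y × z′ ≡ z
        unique {y′} {z′} s′ par′ ne with parent-elim par′ | f z′ in ez
        ... | k′ , P′ | true = y≡ , z≡
          where
          k≡ : k′ ≡ k
          k≡ = Fin.toℕ-injective (ℕ.≤-antisym (max′ s′ P′) (same-layer P P′ (≡ᵇ-sound ez)))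
          z≡ : z′ ≡ z
          z≡ = trans (IsParent.z-first P′) (trans
            (find-cong _ _ λ i → cong₂ (λ k j → (q i ≡ᵇ j) ∧ any λ w → B (toℕ k) w ∧ adj G w i) k≡ (≡ᵇ-sound ez))
            (sym z-first))
          y≡ : y′ ≡ y
          y≡ = trans (IsParent.y-first P′) (trans (find-cong _ _ λ i →
            cong₂ (λ k j → B (toℕ k) i ∧ adj G i j) k≡ z≡) (sym y-first))
        ... | k′ , P′ | false with f y′ in ey
        ...   | false = contradiction refl ne
        -- An edge leading upwards out of the class of `z` would lie above the topmost layer.
        ...   | true  = contradiction
          (B-mono (max′ s′ P′) z (B-class (toℕ k′) (≡ᵇ-sound ey) (IsParent.below P′))) above
        cover : ∀ x y′ → Holds S x y′ → f x ≢ f y′ → (x ≡ y × y′ ≡ z) ⊎ (x ≡ z × y′ ≡ y)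
        cover x y′ s ne with ∨-elim {parent q v x y′} (S⊆ x y′ s)
        ... | inj₁ h = inj₁ (unique (∨-introˡ s) h ne)
        ... | inj₂ h with unique (∨-introʳ {a = S y′ x} s) h (ne ∘ sym)
        ...   | y≡ , z≡ = inj₂ (z≡ , y≡)
        result : Holds S y z ⊎ Holds S z y → ∃[ a ] ∃[ b ] (Holds S a b × f a ≢ f b ×
          (∀ x y → Holds S x y → f x ≢ f y → (x ≡ a × y ≡ b) ⊎ (x ≡ b × y ≡ a)))
        result (inj₁ s) = y , z , s , (λ e → fy (trans e fz)) , cover
        result (inj₂ s) = z , y , s , (λ e → fy (trans (sym e) fz)) , λ x y s ne → swap (cover x y s ne)

∉ᵇ⇒false : ∀ {n} (S : Fin n → Bool) {x} → x ∉ᵇ S → S x ≡ false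
∉ᵇ⇒false S {x} x∉ = Bool.¬-not x∉

fold-shift : ∀ {A : Set} (z : A) (s : A → A) k → fold z s (suc k) ≡ fold (s z) s k
fold-shift z s zero    = refl
fold-shift z s (suc k) = cong s (fold-shift z s k)

-- Regions, one step of the recursion, and the resulting forests

module Levels {m : ℕ} (G : Graph (suc m)) (joined : ∀ u v → Walk G u v) where

  open Contraction G joined public

  module Regions (q : V → V) (D : V → Bool) where

    C : V → V → Bool
    C = component q D

    -- A symmetric form of `bond`, with both ends off the disk. Symmetry makes the regions off the
    -- disk the classes of an equivalence relation, as `C-eq` needs.
    Link : V → V → Set
    Link x y = Inside (_∉ᵇ D) x y ⊎ (q x ≡ q y × x ∉ᵇ D × y ∉ᵇ D)

    C-self : ∀ u → u ∈ᵇ C u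
    C-self u = closure-⊇ (bond q D) (u ≡ᵇ_) u (≡ᵇ-complete refl)

    C-bond : ∀ {u} → Closed (bond q D) (C u)
    C-bond {u} = closure-closed (bond q D) (u ≡ᵇ_)

    C-edge : ∀ {u x y} → x ∈ᵇ C u → y ∉ᵇ D → Edge G x y → y ∈ᵇ C u
    C-edge x∈ y∉ e = C-bond _ _ x∈ (∧-intro (not-intro y∉) (∨-introˡ e))

    C-class : ∀ {u x y} → x ∈ᵇ C u → y ∉ᵇ D → q x ≡ q y → y ∈ᵇ C u
    C-class {u} {x} {y} x∈ y∉ eq = C-bond x y x∈ (∧-intro (not-intro y∉) (∨-introʳ {a = adj G x y} (≡ᵇ-complete eq)))

    C-links : ∀ {u x y} → Star Link x y → x ∈ᵇ C u → y ∈ᵇ C u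
    C-links ε x∈ = x∈
    C-links (inj₁ (e , _ , y∉) ◅ w) x∈ = C-links w (C-edge x∈ y∉ e)
    C-links (inj₂ (eq , _ , y∉) ◅ w) x∈ = C-links w (C-class x∈ y∉ eq)

    bonds⇒links : ∀ {x y} → x ∉ᵇ D → Star (Holds (bond q D)) x y → Star Link x y × y ∉ᵇ D
    bonds⇒links x∉ ε = ε , x∉
    bonds⇒links {x} x∉ (_◅_ {j = z} h w) with ∧-elim {not (D z)} h
    ... | z∉ , h′ with bonds⇒links (not-elim z∉) w | ∨-elim {adj G x z} h′
    ...   | w′ , y∉ | inj₁ e  = inj₁ (e , x∉ , not-elim z∉) ◅ w′ , y∉
    ...   | w′ , y∉ | inj₂ eq = inj₂ (≡ᵇ-sound eq , x∉ , not-elim z∉) ◅ w′ , y∉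

    link-sym : ∀ {x y} → Link x y → Link y x
    link-sym (inj₁ (e , p , p′)) = inj₁ (adj-sym _ _ e , p′ , p)
    link-sym (inj₂ (e , p , p′)) = inj₂ (sym e , p′ , p)

    module _ {u : V} (u∉ : u ∉ᵇ D) where

      C-sound : ∀ {x} → x ∈ᵇ C u → Star Link u x × x ∉ᵇ D
      C-sound {x} x∈ with closure-sound (bond q D) (u ≡ᵇ_) x∈
      ... | s , s≡ , w with ≡ᵇ-sound s≡
      ...   | refl = bonds⇒links u∉ w

      C-eq : ∀ {x} → x ∈ᵇ C u → ∀ y → C x y ≡ C u y
      C-eq {x} x∈ y = ≡-from-⇔ forth back
        where
        w = proj₁ (C-sound x∈)
        x∉ = proj₂ (C-sound x∈)
        forth : y ∈ᵇ C x → y ∈ᵇ C u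
        forth y∈ with closure-sound (bond q D) (x ≡ᵇ_) y∈
        ... | s , s≡ , w′ with ≡ᵇ-sound s≡
        ...   | refl = C-links (proj₁ (bonds⇒links x∉ w′)) x∈
        back : y ∈ᵇ C u → y ∈ᵇ C x
        back y∈ = C-links (Star.reverse link-sym w ◅◅ proj₁ (C-sound y∈)) (C-self x)

  module Level (s : State) where

    q : V → V
    q = proj₁ s

    c : V
    c = center s

    r : ℕ
    r = toℕ (radius s)

    D : V → Bool
    D = disk s

    open Balls q c public
    open Regions q D public

    r≤m : r ≤ m
    r≤m = Fin.toℕ≤pred[n] (radius s)

    c∈D : c ∈ᵇ D
    c∈D = center∈B r

    D-class : ∀ {x y} → q x ≡ q y → x ∈ᵇ D → y ∈ᵇ D
    D-class = B-class r

    module _ {u : V} (u∉ : u ∉ᵇ D) where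

      leader-region : ∀ x → C (leader s u) x ≡ C u x
      leader-region = C-eq u∉ (find-sound (C u) (C-self u))

      q′ : V → V
      q′ = proj₁ (focus s u)

      focus-in : ∀ {x} → x ∈ᵇ C u → q′ x ≡ q x
      focus-in {x} x∈ = cong (λ b → if b then q x else q c) (trans (leader-region x) x∈)

      focus-out : ∀ {x} → x ∉ᵇ C u → q′ x ≡ q c
      focus-out {x} x∉ = cong (λ b → if b then q x else q c) (trans (leader-region x) (∉ᵇ⇒false (C u) x∉))

      region-class : ∀ {x y} → q x ≡ q y → x ∈ᵇ C u → y ∈ᵇ C u
      region-class eq x∈ = C-class x∈ (λ y∈ → proj₂ (C-sound u∉ x∈) (D-class (sym eq) y∈)) eq

      focus-coarser : ∀ x y → q x ≡ q y → q′ x ≡ q′ y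
      focus-coarser x y eq with x ∈ᵇ? C u
      ... | yes x∈ = trans (focus-in x∈) (trans eq (sym (focus-in (region-class eq x∈))))
      ... | no  x∉ = trans (focus-out x∉) (sym (focus-out (λ y∈ → x∉ (region-class (sym eq) y∈))))

      -- The contracted vertex bears the label of `c`. Disks are unions of fibres, so no vertex of
      -- the region has that label and nothing in the region is merged with the outside.
      focus-finer : ∀ {x y} → x ∈ᵇ C u → q′ x ≡ q′ y → y ∈ᵇ C u × q x ≡ q y
      focus-finer {x} {y} x∈ eq with y ∈ᵇ? C u
      ... | yes y∈ = y∈ , trans (sym (focus-in x∈)) (trans eq (focus-in y∈))
      ... | no  y∉ = contradiction (D-class (sym (trans (sym (focus-in x∈)) (trans eq (focus-out y∉)))) c∈D)
                                   (proj₂ (C-sound u∉ x∈))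

      leader-eq : ∀ {x} → x ∈ᵇ C u → focus s x ≡ focus s u
      leader-eq {x} x∈ = cong
        (λ l → (λ y → if region s l y then q y else q c) , (λ y → proj₂ s y ∧ region s l y))
        (find-cong (C x) (C u) (C-eq u∉ x∈))

      descend-left : ∀ {x y} → x ∈ᵇ C u → descend x y s ≡ focus s u
      descend-left {x} {y} x∈ = trans
        (cong (λ b → if b ∧ D y then s else focus s (if b then y else x)) (∉ᵇ⇒false D (proj₂ (C-sound u∉ x∈))))
        (leader-eq x∈)

      -- An edge between disk and region follows its end in the region, so the edges attaching the
      -- region to the contracted vertex are decided together with those inside it.
      descend-right : ∀ {x y} → Edge G x y → y ∈ᵇ C u → descend x y s ≡ focus s u
      descend-right {x} {y} e y∈ = cases (x ∈ᵇ? D)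
        where
        cases : Dec (x ∈ᵇ D) → descend x y s ≡ focus s u
        cases (no x∉)  = descend-left (C-edge y∈ x∉ (adj-sym _ _ e))
        cases (yes x∈) = trans
          (cong₂ (λ b b′ → if b ∧ b′ then s else focus s (if b then y else x)) x∈ (∉ᵇ⇒false D (proj₂ (C-sound u∉ y∈))))
          (leader-eq y∈)

      -- A walk towards `c` can enter the region only from the disk, and once in the disk
      -- `B-connected` leads to `c` without leaving it.
      outside-connected : ConnectedClasses q → ∀ x → x ∉ᵇ C u → Star (Inside (_∉ᵇ C u)) x c
      outside-connected conn x x∉ = go (joined x c) x∉
        where
        within-D : ∀ z → z ∈ᵇ D → z ∉ᵇ C u
        within-D z z∈ z∈C = proj₂ (C-sound u∉ z∈C) z∈
        go : ∀ {x} → Walk G x c → x ∉ᵇ C u → Star (Inside (_∉ᵇ C u)) x c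
        go ε x∉ = ε
        go {x} (e ◅ w) x∉ with x ∈ᵇ? D
        ... | yes x∈ = Inside-map within-D (B-connected conn r x x∈)
        ... | no  x∉D = (e , x∉ , x′∉) ◅ go w x′∉
          where
          x′∉ = λ x′∈ → x∉ (C-edge x′∈ x∉D (adj-sym _ _ e))

      focus-classes : ConnectedClasses q → ConnectedClasses q′
      focus-classes conn x y eq with x ∈ᵇ? C u
      ... | yes x∈ = Inside-map (λ z → focus-coarser z x) (conn x y (proj₂ (focus-finer x∈ eq)))
      ... | no  x∉ = Inside-map (λ z z∉ → trans (focus-out z∉) (sym (focus-out x∉)))
        (outside-connected conn x x∉ ◅◅ inside-sym
          (outside-connected conn y (λ y∈ → x∉ (proj₁ (focus-finer y∈ (sym eq))))))

    descend-inside : ∀ {x y} → x ∈ᵇ D → y ∈ᵇ D → descend x y s ≡ s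
    descend-inside {x} {y} x∈ y∈ = cong₂ (λ b b′ → if b ∧ b′ then s else focus s (if b then y else x)) x∈ y∈

    descend-sym : ∀ {x y} → Edge G x y → descend x y s ≡ descend y x s
    descend-sym {x} {y} e = cases (x ∈ᵇ? D) (y ∈ᵇ? D)
      where
      cases : Dec (x ∈ᵇ D) → Dec (y ∈ᵇ D) → descend x y s ≡ descend y x s
      cases (no x∉) _ = trans (descend-left x∉ (C-self x)) (sym (descend-right x∉ (adj-sym _ _ e) (C-self x)))
      cases (yes x∈) (no y∉) = trans (descend-right y∉ e (C-self y)) (sym (descend-left y∉ (C-self y)))
      cases (yes x∈) (yes y∈) = trans (descend-inside x∈ y∈) (sym (descend-inside y∈ x∈))

  opaque
    unfolding bfs forest

    forest-parent-or : ∀ s x y → Holds (forest 0 s) x y →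
      parent (proj₁ s) (center s) x y ∨ parent (proj₁ s) (center s) y x ≡ true
    forest-parent-or s x y h = proj₂ (∧-elim {adj G x y} h)

    parent-forest : ∀ s y z → Holds (parent (proj₁ s) (center s)) y z → Holds (forest 0 s) z y
    parent-forest s y z h = ∧-intro
      (adj-sym y z (IsParent.edge (proj₂ (parent-elim h)))) (∨-introʳ {a = parent (proj₁ s) (center s) z y} h)
      where open Balls (proj₁ s) (center s)

    forest-edge : ∀ i s x y → Holds (forest i s) x y → Edge G x y
    forest-edge i s x y h = proj₁ (∧-elim {adj G x y} h)

    fold-descend-sym : ∀ i s {x y} → Edge G x y → fold s (descend x y) i ≡ fold s (descend y x) i
    fold-descend-sym zero    s e = refl
    fold-descend-sym (suc i) s {x} {y} e =
      trans (Level.descend-sym (fold s (descend x y) i) e) (cong (descend y x) (fold-descend-sym i s e))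

    bfs-sym : ∀ s x y → Holds (bfs s) x y → Holds (bfs s) y x
    bfs-sym s x y h = trans (Bool.∨-comm (parent (proj₁ s) (center s) y x) _) h

    forest-sym : ∀ i s x y → Holds (forest i s) x y → Holds (forest i s) y x
    forest-sym i s x y h = ∧-intro (adj-sym _ _ e)
      (subst (λ t → Holds (bfs t) y x) (fold-descend-sym i s e)
        (bfs-sym (fold s (descend x y) i) x y (proj₂ (∧-elim {adj G x y} h))))
      where
      e : Edge G x y
      e = proj₁ (∧-elim {adj G x y} h)

    -- Peels off the first descent rather than the last one, which turns the edgewise definition
    -- into the recursive description used in all inductions on the round.
    forest-descend : ∀ i s s′ {x y} → descend x y s ≡ s′ → forest (suc i) s x y ≡ forest i s′ x y
    forest-descend i s s′ {x} {y} eq = cong (λ t → adj G x y ∧ bfs t x y)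
      (trans (fold-shift s (descend x y) i) (cong (λ t → fold t (descend x y) i) eq))

  module _ (s : State) where
    open Level s

    forest-inside : ∀ i {x y} → x ∈ᵇ D → y ∈ᵇ D → forest i s x y ≡ forest 0 s x y
    forest-inside zero    x∈ y∈ = refl
    forest-inside (suc i) x∈ y∈ = trans (forest-descend i s s (descend-inside x∈ y∈)) (forest-inside i x∈ y∈)

    forest-parent : ∀ i y z → Holds (parent q c) y z → y ∈ᵇ D → z ∈ᵇ D → Holds (forest i s) z y
    forest-parent i y z h y∈ z∈ = trans (forest-inside i z∈ y∈) (parent-forest s y z h)

    disk-path : ∀ i {x} → x ∈ᵇ D → ∃[ j ] (j ≤ r × Path q (forest i s) x c j)
    disk-path i x∈ = toCenter (forest i s) r r≤m (forest-parent i) r ℕ.≤-refl _ x∈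

    module _ (i : ℕ) {u : V} (u∉ : u ∉ᵇ D) where

      forest-left : ∀ {x y} → x ∈ᵇ C u → forest (suc i) s x y ≡ forest i (focus s u) x y
      forest-left x∈ = forest-descend i s (focus s u) (descend-left u∉ x∈)

      forest-right : ∀ {x y} → Edge G x y → y ∈ᵇ C u → forest (suc i) s x y ≡ forest i (focus s u) x y
      forest-right e y∈ = forest-descend i s (focus s u) (descend-right u∉ e y∈)

      -- Free jumps cannot leave the region, by `focus-finer`, and an edge can leave it only into
      -- the disk. Up to that point both labellings and both forests agree, so the path is copied
      -- unchanged.
      first-exit : ∀ {x y k} → x ∈ᵇ C u → Path (q′ u∉) (forest i (focus s u)) x y k →
        (y ∈ᵇ C u × Path q (forest (suc i) s) x y k) ⊎
        ∃[ p ] ∃[ k₁ ] ∃[ k₂ ] (p ∈ᵇ D × Path q (forest (suc i) s) x p k₁ ×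
          Path (q′ u∉) (forest i (focus s u)) p y k₂ × k₁ + k₂ ≡ k)
      first-exit x∈ (stop eq) with focus-finer u∉ x∈ eq
      ... | y∈ , eq′ = inj₁ (y∈ , stop eq′)
      first-exit x∈ (_∷⟨_⟩_ {x′ = x′} {y = y} {k = k} eq h p) with focus-finer u∉ x∈ eq
      ... | x′∈ , eq′ with y ∈ᵇ? D
      ...   | yes y∈ = inj₂ (y , 1 , k , y∈ , eq′ ∷⟨ trans (forest-left x′∈) h ⟩ stop refl , p , refl)
      ...   | no  y∉ with first-exit (C-edge x′∈ y∉ (forest-edge i (focus s u) _ _ h)) p
      ...     | inj₁ (z∈ , p′) = inj₁ (z∈ , eq′ ∷⟨ trans (forest-left x′∈) h ⟩ p′)
      ...     | inj₂ (z , k₁ , k₂ , z∈ , p₁ , p₂ , refl) =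
        inj₂ (z , suc k₁ , k₂ , z∈ , eq′ ∷⟨ trans (forest-left x′∈) h ⟩ p₁ , p₂ , refl)

  independent-⊆ : ∀ {q} {E E′ : V → V → Bool} → (∀ x y → Holds E x y → Holds E′ x y) → Independent q E′ → Independent q E
  independent-⊆ sub ind S S⊆ = ind S λ x y h → sub x y (S⊆ x y h)

  -- If all of S lies in the disk, the breadth-first tree supplies the cut. Otherwise some edge of S
  -- touches a region; the cut found for the edges of S touching that region is constant on the rest
  -- of the graph, which is a single fibre there, so no other edge of S crosses it.
  forest-independent : ∀ i s → Independent (proj₁ s) (forest i s)
  forest-independent zero s = independent-⊆ (forest-parent-or s) (Level.bfs-independent s)
  forest-independent (suc i) s S S⊆ x₀ y₀ s₀ with any (λ x → any λ y → S x y ∧ not (disk s x ∧ disk s y)) in eq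
  ... | false = forest-independent zero s S inside x₀ y₀ s₀
    where
    open Level s
    inside : ∀ x y → Holds S x y → Holds (forest 0 s) x y
    inside x y h with (disk s x ∧ disk s y) Bool.≟ true
    ... | yes d with ∧-elim {disk s x} d
    ...   | x∈ , y∈ = trans (sym (forest-inside s (suc i) x∈ y∈)) (S⊆ x y h)
    inside x y h | no d = contradiction
      (trans (sym eq) (any-intro _ x (any-intro _ y (∧-intro h (not-intro d))))) λ ()
  ... | true with any-elim _ eq
  ...   | a , h₁ with any-elim _ h₁
  ...     | b , h₂ with ∧-elim {S a b} h₂
  ...       | ab , out = outside (a ∈ᵇ? disk s)
    where
    open Level s
    Goal = Σ (V → Bool) λ f → (∀ x y → q x ≡ q y → f x ≡ f y) ×
      ∃[ a ] ∃[ b ] (Holds S a b × f a ≢ f b ×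
        (∀ x y → Holds S x y → f x ≢ f y → (x ≡ a × y ≡ b) ⊎ (x ≡ b × y ≡ a)))
    solve : ∀ {u} (u∉ : u ∉ᵇ D) → C u a ∨ C u b ≡ true → Goal
    solve {u} u∉ touch = extend (forest-independent i (focus s u) S′ S′⊆ a b (∧-intro ab touch))
      where
      S′ : V → V → Bool
      S′ x y = S x y ∧ (C u x ∨ C u y)
      S′⊆ : ∀ x y → Holds S′ x y → Holds (forest i (focus s u)) x y
      S′⊆ x y h with ∧-elim {S x y} h
      ... | h′ , t with ∨-elim {C u x} t
      ...   | inj₁ x∈ = trans (sym (forest-left s i u∉ x∈)) (S⊆ x y h′)
      ...   | inj₂ y∈ = trans (sym (forest-right s i u∉ (forest-edge (suc i) s x y (S⊆ x y h′)) y∈)) (S⊆ x y h′)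
      extend : (Σ (V → Bool) λ f → (∀ x y → q′ u∉ x ≡ q′ u∉ y → f x ≡ f y) ×
        ∃[ a ] ∃[ b ] (Holds S′ a b × f a ≢ f b ×
          (∀ x y → Holds S′ x y → f x ≢ f y → (x ≡ a × y ≡ b) ⊎ (x ≡ b × y ≡ a)))) → Goal
      extend (f , resp , a′ , b′ , h , ne , unique) =
        f , (λ x y e → resp x y (focus-coarser u∉ x y e)) , a′ , b′ , proj₁ (∧-elim {S a′ b′} h) , ne ,
        λ x y h ne′ → unique x y (∧-intro h (touches x y ne′)) ne′
        where
        touches : ∀ x y → f x ≢ f y → C u x ∨ C u y ≡ true
        touches x y ne with x ∈ᵇ? C u | y ∈ᵇ? C u
        ... | yes x∈ | _      = ∨-introˡ x∈
        ... | no  _  | yes y∈ = ∨-introʳ {a = C u x} y∈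
        ... | no  x∉ | no  y∉ = contradiction (resp x y (trans (focus-out u∉ x∉) (sym (focus-out u∉ y∉)))) ne
    outside : Dec (a ∈ᵇ disk s) → Goal
    outside (no a∉) = solve a∉ (∨-introˡ (C-self a))
    outside (yes a∈) = solve b∉ (∨-introʳ {a = C b a} (C-self b))
      where
      b∉ : b ∉ᵇ D
      b∉ b∈ = not-elim out (∧-intro a∈ b∈)

  -- From `x` off the disk, a path to `c` in the forest of the smaller state has to leave the
  -- region. Its part before the exit is kept, and the tree inside the disk continues to `c`.
  forest-connected : ∀ i s x y → ∃[ k ] Path (proj₁ s) (forest i s) x y k
  forest-connected i s x y with to-center i x | to-center i y
    where
    open Level s
    to-center : ∀ i x → ∃[ k ] Path q (forest i s) x c k
    to-center zero x with toCenter (forest 0 s) m ℕ.≤-refl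
      (λ y z h _ _ → parent-forest s y z h) m ℕ.≤-refl x (B-full x)
    ... | k , _ , p = k , p
    to-center (suc i) x with x ∈ᵇ? D
    ... | yes x∈ with disk-path s (suc i) x∈
    ...   | k , _ , p = k , p
    to-center (suc i) x | no x∉ with forest-connected i (focus s x) x c
    ...   | k , p with first-exit s i x∉ (C-self x) p
    ...     | inj₁ (c∈ , _) = contradiction c∈D (proj₂ (C-sound x∉ c∈))
    ...     | inj₂ (z , k₁ , _ , z∈ , p₁ , _) with disk-path s (suc i) z∈
    ...       | j , _ , p₂ = k₁ + j , p₁ ++ₚ p₂
  ... | j , p | k , p′ = j + k , p ++ₚ reverseₚ (forest-sym i s) p′

-- Halving and stretch

module Stretch {m : ℕ} (G : Graph (suc m)) (joined : ∀ u v → Walk G u v) where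

  open Levels G joined public

  BalancedWithin : ℕ → Set
  BalancedWithin ρ = ∀ s → ConnectedClasses (proj₁ s) → ∃[ v ] ∃[ r ] (toℕ r ≤ ρ × balanced s v r ≡ true)

  module _ (s : State) where
    open Level s

    opaque
      unfolding center

      radius-least : ∀ {v r′} → balanced s v r′ ≡ true → toℕ (radius s) ≤ toℕ r′
      radius-least b = find-least (λ r → any λ v → balanced s v r) (any-intro _ _ b)

      center-balanced : ∀ {v r′} → balanced s v r′ ≡ true → balanced s c (radius s) ≡ true
      center-balanced b with any-elim _ (find-sound (λ r → any λ v → balanced s v r) (any-intro _ _ b))
      ... | v , b′ = find-sound (λ v → balanced s v (radius s)) {v} b′

    half : ∀ {v r′} → balanced s v r′ ≡ true → ∀ {u} (u∉ : u ∉ᵇ D) →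
           count (proj₂ (focus s u)) + count (proj₂ (focus s u)) ≤ count (proj₂ s)
    half b {u} u∉ = subst₂ _≤_ (cong₂ _+_ same same) (count-split W (C u)) (ℕ.+-monoʳ-≤ (count (λ x → W x ∧ C u x)) light)
      where
      W = proj₂ s
      same : count (λ x → W x ∧ C u x) ≡ count (proj₂ (focus s u))
      same = count-cong _ _ λ x → cong (W x ∧_) (sym (leader-region u∉ x))
      light : count (λ x → W x ∧ C u x) ≤ count (λ x → W x ∧ not (C u x))
      light = ℕ.≮⇒≥ λ lt → not-elim (center-balanced b)
        (any-intro _ u (∧-intro (not-intro u∉) (heavy-complete W (C u) lt)))

    near-center : ∀ {k x} → x ∈ᵇ B k → ∃[ j ] (j ≤ k × Path q (forest 0 s) x c j)
    near-center {k} {x} x∈ with ℕ.≤-total k m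
    ... | inj₁ k≤m = toCenter (forest 0 s) m ℕ.≤-refl (λ y z h _ _ → parent-forest s y z h) k k≤m x x∈
    ... | inj₂ m≤k with toCenter (forest 0 s) m ℕ.≤-refl (λ y z h _ _ → parent-forest s y z h) m ℕ.≤-refl x (B-full x)
    ...   | j , j≤m , p = j , ℕ.≤-trans j≤m m≤k , p

    -- As `z` is within `r` of the centre, `x` is within `k₁ + r` and `y` within `k₂ + r`; the
    -- breadth-first tree realises both bounds, and the path is routed through the centre.
    through-disk : ∀ {x y z k₁ k₂} → z ∈ᵇ D → Path q (adj G) x z k₁ → Path q (adj G) z y k₂ →
                   ∃[ l ] (l ≤ (k₁ + k₂) + (r + r) × Path q (forest 0 s) x y l)
    through-disk {k₁ = k₁} {k₂} z∈ p₁ p₂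
      with near-center (path⇒∈B (λ _ _ e → e) r z∈ (reverseₚ adj-sym p₁))
         | near-center (path⇒∈B (λ _ _ e → e) r z∈ p₂)
    ... | j₁ , j₁≤ , q₁ | j₂ , j₂≤ , q₂ =
      j₁ + j₂ , ℕ.≤-trans (ℕ.+-mono-≤ j₁≤ j₂≤) (ℕ.≤-reflexive (interchange k₁ r k₂ r)) ,
      q₁ ++ₚ reverseₚ (forest-sym 0 s) q₂

    hit-or-miss : ∀ {u x y k} (u∉ : u ∉ᵇ D) → x ∈ᵇ C u → Path q (adj G) x y k →
      (∃[ z ] ∃[ k₁ ] ∃[ k₂ ] (z ∈ᵇ D × Path q (adj G) x z k₁ × Path q (adj G) z y k₂ × k₁ + k₂ ≡ k)) ⊎
      (y ∈ᵇ C u × Path (q′ u∉) (adj G) x y k)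
    hit-or-miss u∉ x∈ (stop eq) = inj₂ (region-class u∉ eq x∈ , stop (focus-coarser u∉ _ _ eq))
    hit-or-miss u∉ x∈ (_∷⟨_⟩_ {y = y} {k = k} eq e p) with y ∈ᵇ? D
    ... | yes y∈ = inj₁ (y , 1 , k , y∈ , eq ∷⟨ e ⟩ stop refl , p , refl)
    ... | no  y∉ with hit-or-miss u∉ (C-edge (region-class u∉ eq x∈) y∉ e) p
    ...   | inj₁ (z , k₁ , k₂ , z∈ , p₁ , p₂ , refl) = inj₁ (z , suc k₁ , k₂ , z∈ , eq ∷⟨ e ⟩ p₁ , p₂ , refl)
    ...   | inj₂ (y∈ , p′) = inj₂ (y∈ , focus-coarser u∉ _ _ eq ∷⟨ e ⟩ p′)

    -- A path of the contracted tree uses the contracted vertex at most once, and then the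
    -- tree inside the disk closes the gap with at most 2r further edges.
    expand : ∀ i {u x y l} (u∉ : u ∉ᵇ D) → x ∈ᵇ C u → y ∈ᵇ C u → Path (q′ u∉) (forest i (focus s u)) x y l →
             ∃[ l′ ] (l′ ≤ l + (r + r) × Path q (forest (suc i) s) x y l′)
    expand i {l = l} u∉ x∈ y∈ p with first-exit s i u∉ x∈ p
    ... | inj₁ (_ , p′) = l , ℕ.m≤m+n l _ , p′
    -- The rest is read backwards from `y`. The stretch of length `k₄` between the two exits is
    -- discarded in favour of a detour through the centre.
    ... | inj₂ (z , k₁ , k₂ , z∈ , p₁ , rest , refl) with first-exit s i u∉ y∈ (reverseₚ (forest-sym i _) rest)
    ...   | inj₁ (z∈C , _) = contradiction z∈ (proj₂ (C-sound u∉ z∈C))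
    ...   | inj₂ (w , k₃ , k₄ , w∈ , p₃ , _ , refl) with disk-path s (suc i) z∈ | disk-path s (suc i) w∈
    ...     | j₁ , j₁≤ , d₁ | j₂ , j₂≤ , d₂ =
      (k₁ + j₁) + (k₃ + j₂) ,
      (begin
        (k₁ + j₁) + (k₃ + j₂)        ≤⟨ ℕ.+-mono-≤ (ℕ.+-monoʳ-≤ k₁ j₁≤) (ℕ.+-mono-≤ (ℕ.m≤m+n k₃ k₄) j₂≤) ⟩
        (k₁ + r) + (k₃ + k₄ + r)     ≡⟨ interchange k₁ r (k₃ + k₄) r ⟩
        (k₁ + (k₃ + k₄)) + (r + r)   ∎) ,
      (p₁ ++ₚ d₁) ++ₚ reverseₚ (forest-sym (suc i) s) (p₃ ++ₚ d₂)
      where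
      open ℕ.≤-Reasoning

  two≤count : ∀ {x y : V} (W : V → Bool) → x ∈ᵇ W → y ∈ᵇ W → x ≢ y → 2 ≤ count W
  two≤count {x} {y} W x∈ y∈ x≢y = subst (2 ≤_) (count-delete W x x∈)
    (s≤s (count-positive _ {y} (∧-intro y∈ (not-intro λ e → x≢y (sym (≡ᵇ-sound e))))))

  module _ {ρ : ℕ} (good : BalancedWithin ρ) where

    -- Every round halves W, so the exponent falls by one. A path meeting the disk pays 2ρ in the
    -- tree of that round; a path missing it survives in one region and pays 2ρ when the result is
    -- expanded. Two distinct vertices in W rule out `M = 0`, where W has fewer than two elements.
    stretch : ∀ M s → ConnectedClasses (proj₁ s) → count (proj₂ s) < 2 ^ suc M →
              ∀ {x y k} → x ∈ᵇ proj₂ s → y ∈ᵇ proj₂ s → x ≢ y → Path (proj₁ s) (adj G) x y k →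
              ∃[ i ] (i < M × ∃[ l ] (l ≤ k + M * (2 * ρ) × Path (proj₁ s) (forest i s) x y l))
    stretch zero s conn small x∈ y∈ x≢y p = contradiction (two≤count (proj₂ s) x∈ y∈ x≢y) (ℕ.<⇒≱ small)
    stretch (suc M) s conn small {x} {y} {k} x∈ y∈ x≢y p with good s conn
    ... | v , r′ , r′≤ρ , b = cases (x ∈ᵇ? D)
      where
      open Level s
      Goal : Set
      Goal = ∃[ i ] (i < suc M × ∃[ l ] (l ≤ k + suc M * (2 * ρ) × Path q (forest i s) x y l))
      r+r≤ : r + r ≤ 2 * ρ
      r+r≤ = subst (r + r ≤_) (cong (ρ +_) (sym (ℕ.+-identityʳ ρ))) (ℕ.+-mono-≤ r≤ρ r≤ρ)
        where r≤ρ = ℕ.≤-trans (radius-least s b) r′≤ρ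
      hit : ∃[ z ] ∃[ k₁ ] ∃[ k₂ ] (z ∈ᵇ D × Path q (adj G) x z k₁ × Path q (adj G) z y k₂ × k₁ + k₂ ≡ k) → Goal
      hit (z , k₁ , k₂ , z∈ , p₁ , p₂ , refl) with through-disk s z∈ p₁ p₂
      ... | l , l≤ , p′ = 0 , s≤s z≤n , l , ℕ.≤-trans l≤
        (ℕ.+-monoʳ-≤ (k₁ + k₂) (ℕ.≤-trans r+r≤ (ℕ.m≤m+n (2 * ρ) (M * (2 * ρ))))) , p′
      cases : Dec (x ∈ᵇ D) → Goal
      cases (yes x∈D) = hit (x , 0 , k , x∈D , stop refl , p , refl)
      cases (no x∉) with hit-or-miss s x∉ (C-self x) p
      ... | inj₁ h = hit h
      ... | inj₂ (y∈C , p′) with stretch M (focus s x) (focus-classes x∉ conn) smaller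
                (member x∈ (C-self x)) (member y∈ y∈C) x≢y p′
        where
        W = proj₂ s
        W′ = proj₂ (focus s x)
        member : ∀ {z} → z ∈ᵇ W → z ∈ᵇ C x → z ∈ᵇ W′
        member {z} z∈ z∈C = ∧-intro z∈ (trans (leader-region x∉ z) z∈C)
        smaller : count W′ < 2 ^ suc M
        smaller = ℕ.*-cancelˡ-< 2 _ _ (ℕ.≤-<-trans
          (subst (_≤ count W) (cong (count W′ +_) (sym (ℕ.+-identityʳ (count W′)))) (half s b x∉)) small)
      ...   | i , i<M , l , l≤ , p″ with expand s i x∉ (C-self x) y∈C p″
      ...     | l′ , l′≤ , p‴ = suc i , s≤s i<M , l′ , bound , p‴
        where
        open ℕ.≤-Reasoning
        bound : l′ ≤ k + suc M * (2 * ρ)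
        bound = begin
          l′                            ≤⟨ l′≤ ⟩
          l + (r + r)                   ≤⟨ ℕ.+-mono-≤ l≤ r+r≤ ⟩
          k + M * (2 * ρ) + 2 * ρ       ≡⟨ ℕ.+-assoc k _ _ ⟩
          k + (M * (2 * ρ) + 2 * ρ)     ≡⟨ cong (k +_) (ℕ.+-comm _ (2 * ρ)) ⟩
          k + suc M * (2 * ρ)           ∎

-- Trees and distances

module _ {n} (T : Graph n) where

  steps : ∀ {u v} → Walk T u v → Fin n → Fin n → Bool
  steps ε x y = false
  steps (_◅_ {i = i} {j} e w) x y = (x ≡ᵇ i) ∧ (y ≡ᵇ j) ∨ steps w x y

  steps-elim : ∀ {u z v} (e : Edge T u z) (w : Walk T z v) {x y} → Holds (steps (e ◅ w)) x y →
               (x ≡ u × y ≡ z) ⊎ Holds (steps w) x y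
  steps-elim {u} {z} e w {x} {y} h with ∨-elim {(x ≡ᵇ u) ∧ (y ≡ᵇ z)} h
  ... | inj₂ h′ = inj₂ h′
  ... | inj₁ h′ with ∧-elim {x ≡ᵇ u} h′
  ...   | ex , ey = inj₁ (≡ᵇ-sound ex , ≡ᵇ-sound ey)

  steps-first : ∀ {u z v} (e : Edge T u z) (w : Walk T z v) → Holds (steps (e ◅ w)) u z
  steps-first {u} {z} e w = ∨-introˡ {a = (u ≡ᵇ u) ∧ (z ≡ᵇ z)} (∧-intro (≡ᵇ-complete refl) (≡ᵇ-complete refl))

  steps-rest : ∀ {u z v} (e : Edge T u z) (w : Walk T z v) {x y} → Holds (steps w) x y → Holds (steps (e ◅ w)) x y
  steps-rest {u} {z} e w {x} {y} h = ∨-introʳ {a = (x ≡ᵇ u) ∧ (y ≡ᵇ z)} h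

  steps-edge : ∀ {u v} (w : Walk T u v) {x y} → Holds (steps w) x y → Edge T x y
  steps-edge (e ◅ w) h with steps-elim e w h
  ... | inj₁ (refl , refl) = e
  ... | inj₂ h′            = steps-edge w h′

  start∈ : ∀ {u v} (w : Walk T u v) → u ∈ vertices w
  start∈ ε       = here refl
  start∈ (_ ◅ _) = here refl

  end∈ : ∀ {u v} (w : Walk T u v) → v ∈ vertices w
  end∈ ε       = here refl
  end∈ (_ ◅ w) = there (end∈ w)

  steps-vertices : ∀ {u v} (w : Walk T u v) {x y} → Holds (steps w) x y → x ∈ vertices w × y ∈ vertices w
  steps-vertices (e ◅ w) h with steps-elim e w h
  ... | inj₁ (refl , refl) = here refl , there (start∈ w)
  ... | inj₂ h′ with steps-vertices w h′
  ...   | x∈ , y∈ = there x∈ , there y∈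

  crossing : (f : Fin n → Bool) → ∀ {u v} (w : Walk T u v) → f u ≢ f v →
             ∃[ x ] ∃[ y ] (Holds (steps w) x y × f x ≢ f y)
  crossing f ε ne = contradiction refl ne
  crossing f {u} (_◅_ {j = z} e w) ne with f u Bool.≟ f z
  ... | no  ne′ = u , z , steps-first e w , ne′
  ... | yes eq with crossing f w (ne ∘ trans eq)
  ...   | x , y , h , ne′ = x , y , steps-rest e w h , ne′

  fresh : ∀ {x : Fin n} {xs} → Unique (x ∷ xs) → ¬ x ∈ xs
  fresh (x≢ ∷ _) x∈ = All.lookup x≢ x∈ refl

  -- A closed walk that crosses a cut crosses it at least twice. On a cycle both crossings would use
  -- the one edge of the cut, which repeats a vertex of the path.
  independent⇒acyclic : Independent id (adj T) → Acyclic T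
  independent⇒acyclic ind u v e w uniq long
    with ind S S⊆ u v (∨-introˡ (∧-intro (≡ᵇ-complete refl) (≡ᵇ-complete refl)))
    where
    S : Fin n → Fin n → Bool
    S x y = (x ≡ᵇ u) ∧ (y ≡ᵇ v) ∨ steps w x y
    S⊆ : ∀ x y → Holds S x y → Edge T x y
    S⊆ x y h = steps-edge (e ◅ w) h
  ... | f , _ , a , b , ab , a≢b , unique = cases (f u Bool.≟ f v)
    where
    Same : Fin n → Fin n → Set
    Same x y = (x ≡ a × y ≡ b) ⊎ (x ≡ b × y ≡ a)
    shared : ∀ {x y x′ y′} → Same x y → Same x′ y′ → (x ≡ x′ × y ≡ y′) ⊎ (x ≡ y′ × y ≡ x′)
    shared (inj₁ (refl , refl)) (inj₁ (refl , refl)) = inj₁ (refl , refl)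
    shared (inj₁ (refl , refl)) (inj₂ (refl , refl)) = inj₂ (refl , refl)
    shared (inj₂ (refl , refl)) (inj₁ (refl , refl)) = inj₂ (refl , refl)
    shared (inj₂ (refl , refl)) (inj₂ (refl , refl)) = inj₁ (refl , refl)
    same : ∀ {x y} → Holds (steps w) x y → f x ≢ f y → Same x y
    same {x} {y} h = unique x y (∨-introʳ {a = (x ≡ᵇ u) ∧ (y ≡ᵇ v)} h)
    reappears : ∀ {x y x′ y′ z} (w′ : Walk T y z) → Same x y → Holds (steps w′) x′ y′ → Same x′ y′ → x ∈ vertices w′
    reappears w′ s h s′ with shared s s′
    ... | inj₁ (refl , _) = proj₁ (steps-vertices w′ h)
    ... | inj₂ (refl , _) = proj₂ (steps-vertices w′ h)
    no-return : ∀ {x y} (w′ : Walk T x y) → Unique (vertices w′) →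
                (∀ {x y} → Holds (steps w′) x y → f x ≢ f y → Same x y) →
                f x ≡ f y → ∀ {x′ y′} → Holds (steps w′) x′ y′ → f x′ ≢ f y′ → ⊥
    no-return {x} (_◅_ {j = z} e′ w′) uniq′@(_ ∷ uniq″) sm eq h ne with f x Bool.≟ f z
    ... | no  ne′ with crossing f w′ (λ eq′ → ne′ (trans eq (sym eq′)))
    ...   | _ , _ , h′ , ne″ = fresh uniq′ (reappears w′ (sm (steps-first e′ w′) ne′) h′ (sm (steps-rest e′ w′ h′) ne″))
    no-return {x} (_◅_ {j = z} e′ w′) uniq′@(_ ∷ uniq″) sm eq h ne | yes eq′ with steps-elim e′ w′ h
    ... | inj₁ (refl , refl) = ne eq′
    ... | inj₂ h′ = no-return w′ uniq″ (sm ∘ steps-rest e′ w′) (trans (sym eq′) eq) h′ ne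
    leaves : f u ≢ f v → (w′ : Walk T v u) → Unique (vertices w′) → 2 ≤ walkLength w′ →
             (∀ {x y} → Holds (steps w′) x y → f x ≢ f y → Same x y) → ⊥
    leaves ne (_◅_ {j = z} e′ w′) uniq′ long′ sm with f v Bool.≟ f z
    ... | yes eq with crossing f w′ (λ eq′ → ne (sym (trans eq eq′)))
    ...   | x , y , h , ne′ with shared (unique u v (∨-introˡ (∧-intro (≡ᵇ-complete refl) (≡ᵇ-complete refl))) ne) (sm (steps-rest e′ w′ h) ne′)
    ...     | inj₁ (_ , refl) = fresh uniq′ (proj₂ (steps-vertices w′ h))
    ...     | inj₂ (_ , refl) = fresh uniq′ (proj₁ (steps-vertices w′ h))
    leaves ne (_◅_ {j = z} e′ w′) uniq′ long′ sm | no ne′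
      with shared (unique u v (∨-introˡ (∧-intro (≡ᵇ-complete refl) (≡ᵇ-complete refl))) ne) (sm (steps-first e′ w′) ne′)
    ... | inj₁ (refl , refl) = ne refl
    -- The first step of `w` already returns to `u`; having length at least 2, `w` would visit `u`
    -- again at its end.
    ... | inj₂ (refl , _) with w′ | uniq′ | long′
    ...   | ε | _ | s≤s ()
    ...   | _ ◅ w″ | _ ∷ uniq″ | _ = fresh uniq″ (end∈ w″)
    cases : Dec (f u ≡ f v) → ⊥
    cases (no ne) = leaves ne w uniq long same
    cases (yes eq) with ∨-elim {(a ≡ᵇ u) ∧ (b ≡ᵇ v)} ab
    ... | inj₂ h = no-return w uniq same (sym eq) h a≢b
    ... | inj₁ h with ∧-elim {a ≡ᵇ u} h
    ...   | ea , eb with ≡ᵇ-sound ea | ≡ᵇ-sound eb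
    ...     | refl | refl = a≢b eq

  path⇒walk : ∀ {x y k} → Path id (adj T) x y k → Σ (Walk T x y) λ w → walkLength w ≡ k
  path⇒walk (stop refl) = ε , refl
  path⇒walk (refl ∷⟨ e ⟩ p) with path⇒walk p
  ... | w , eq = e ◅ w , cong suc eq

  walk⇒path : ∀ {x y} (w : Walk T x y) → Path id (adj T) x y (walkLength w)
  walk⇒path ε       = stop refl
  walk⇒path (e ◅ w) = refl ∷⟨ e ⟩ walk⇒path w

  walkOfLength? : ∀ k x y → Dec (Σ (Walk T x y) λ w → walkLength w ≡ k)
  walkOfLength? zero x y = map′ (λ { refl → ε , refl }) (λ { (ε , _) → refl }) (x ≟ y)
  walkOfLength? (suc k) x y = map′
    (λ { (z , e , w , eq) → e ◅ w , cong suc eq })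
    (λ { (e ◅ w , eq) → _ , e , w , ℕ.suc-injective eq })
    (Fin.any? λ z → (adj T x z Bool.≟ true) ×-dec walkOfLength? k z y)

least : {P : ℕ → Set} → (∀ k → Dec (P k)) → ∀ k → P k → ∃[ d ] (IsMinimum P d × d ≤ k)
least {P} P? zero p = 0 , (p , λ _ _ → z≤n) , z≤n
least {P} P? (suc k) p with P? 0
... | yes p₀ = 0 , (p₀ , λ _ _ → z≤n) , z≤n
... | no ¬p₀ with least (P? ∘ suc) k p
...   | d , (pd , min) , d≤k = suc d , (pd , λ { zero p₀ → contradiction p₀ ¬p₀ ; (suc j) pⱼ → s≤s (min j pⱼ) }) , s≤s d≤k

distance≤ : ∀ {n} (T : Graph n) {x y} (w : Walk T x y) → ∃[ d ] (Distance T x y d × d ≤ walkLength w)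
distance≤ T {x} {y} w = least (λ k → walkOfLength? T k x y) (walkLength w) (w , refl)

-- Bounds for the integer logarithm

log-halve : ∀ k → ⌊log₂ suc (suc k) ⌋ ≡ suc ⌊log₂ ⌊ suc (suc k) /2⌋ ⌋
log-halve k = trans (sym (ℕ.m+[n∸m]≡n pos)) (cong suc (sym (⌊log₂⌊n/2⌋⌋≡⌊log₂n⌋∸1 (suc (suc k)))))
  where
  pos : 1 ≤ ⌊log₂ suc (suc k) ⌋
  pos = subst (_≤ ⌊log₂ suc (suc k) ⌋) (⌊log₂[2^n]⌋≡n 1) (⌊log₂⌋-mono-≤ {2} {suc (suc k)} (s≤s (s≤s z≤n)))

2^⌊log₂⌋≤ : ∀ n → .{{NonZero n}} → 2 ^ ⌊log₂ n ⌋ ≤ n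
2^⌊log₂⌋≤ n = <-rec (λ n → 0 < n → 2 ^ ⌊log₂ n ⌋ ≤ n) step n (>-nonZero⁻¹ n)
  where
  step : ∀ n → (∀ {k} → k < n → 0 < k → 2 ^ ⌊log₂ k ⌋ ≤ k) → 0 < n → 2 ^ ⌊log₂ n ⌋ ≤ n
  step 1 rec _ = ℕ.≤-refl
  step n@(suc (suc k)) rec _ = begin
    2 ^ ⌊log₂ n ⌋               ≡⟨ cong (2 ^_) (log-halve k) ⟩
    2 * 2 ^ ⌊log₂ h ⌋           ≤⟨ ℕ.*-monoʳ-≤ 2 (rec (ℕ.⌊n/2⌋<n (suc k)) (s≤s z≤n)) ⟩
    2 * h                       ≡⟨ cong (h +_) (ℕ.+-identityʳ h) ⟩
    h + h                       ≤⟨ ℕ.+-monoʳ-≤ h (ℕ.⌊n/2⌋≤⌈n/2⌉ n) ⟩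
    h + ⌈ n /2⌉        ≡⟨ ℕ.⌊n/2⌋+⌈n/2⌉≡n n ⟩
    n                           ∎
    where
    open ℕ.≤-Reasoning
    h = ⌊ n /2⌋

n<2^1+⌊log₂⌋ : ∀ n → n < 2 ^ suc ⌊log₂ n ⌋
n<2^1+⌊log₂⌋ n = ℕ.≰⇒> λ le → ℕ.1+n≰n
  (subst (_≤ ⌊log₂ n ⌋) (⌊log₂[2^n]⌋≡n (suc ⌊log₂ n ⌋)) (⌊log₂⌋-mono-≤ le))

-- Raise `2 ^ ⌊log₂ n ⌋ ≤ n` to the power `k` and take logarithms. This converts rounds times 2ρ
-- into the additive stretch of the theorem.
⌊log₂⌋*≤ : ∀ n k → .{{NonZero n}} → ⌊log₂ n ⌋ * k ≤ ⌊ k ·log₂ n ⌋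
⌊log₂⌋*≤ n k = subst (_≤ ⌊ k ·log₂ n ⌋) (⌊log₂[2^n]⌋≡n (⌊log₂ n ⌋ * k)) (⌊log₂⌋-mono-≤
  (ℕ.≤-trans (ℕ.≤-reflexive (sym (ℕ.^-*-assoc 2 ⌊log₂ n ⌋ k))) (ℕ.^-monoˡ-≤ k (2^⌊log₂⌋≤ n))))

-- Loop erasure and branches of a tree

module _ {n} {R : Fin n → Fin n → Set} where

  suffix : ∀ {x y z} (w : Star R y z) → Unique (vertices w) → x ∈ vertices w → Σ (Star R x z) (Unique ∘ vertices)
  suffix ε       u       (here refl) = ε , u
  suffix (r ◅ w) u       (here refl) = r ◅ w , u
  suffix (r ◅ w) (_ ∷ u) (there x∈)  = suffix w u x∈

  loop-erasure : ∀ {x z} → Star R x z → Σ (Star R x z) (Unique ∘ vertices)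
  loop-erasure ε = ε , [] ∷ []
  loop-erasure {x} (r ◅ w) with loop-erasure w
  ... | w′ , u with dec-∈ _≟_ x (vertices w′)
  ...   | yes x∈ = suffix w′ u x∈
  ...   | no  x∉ = r ◅ w′ , All.¬Any⇒All¬ _ x∉ ∷ u

  vertices-map : ∀ {R′ : Fin n → Fin n → Set} (f : ∀ {x y} → R x y → R′ x y) {x y} (w : Star R x y) →
                 vertices (Star.map f w) ≡ vertices w
  vertices-map f ε       = refl
  vertices-map f (r ◅ w) = cong (_ ∷_) (vertices-map f w)

module TreeBranches {n} (T : Graph n) (tree : IsTree T) where

  Off : Fin n → Fin n → Fin n → Set
  Off i x y = Edge T x y × x ≢ i × y ≢ i

  ed-sym : ∀ {x y} → Edge T x y → Edge T y x
  ed-sym {x} {y} e = trans (sym (Graph.symmetric T x y)) e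

  off-sym : ∀ {i x y} → Star (Off i) x y → Star (Off i) y x
  off-sym = Star.reverse λ (e , p , p′) → ed-sym e , p′ , p

  -- After loop erasure the walk has length 0, which would make `i` a loop, or 1, which is the
  -- forbidden step, or at least 2, which closes a cycle with the edge.
  bridge : ∀ {i j} → Edge T i j → ¬ Star (λ x y → Edge T x y × ¬ (x ≡ j × y ≡ i)) j i
  bridge {i} {j} e w with loop-erasure w
  ... | ε , _ = contradiction (trans (sym e) (Graph.irreflexive T i)) λ ()
  ... | (_ , ≢ji) ◅ ε , _ = ≢ji (refl , refl)
  ... | w′@(_ ◅ _ ◅ _) , u = proj₂ tree i j e (Star.map proj₁ w′)
    (subst Unique (sym (vertices-map proj₁ w′)) u) (s≤s (s≤s z≤n))

  last-visit : ∀ {i x a} → Star (Edge T) x a → a ≢ i →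
               (x ≢ i × Star (Off i) x a) ⊎ ∃[ j ] (Edge T i j × j ≢ i × Star (Off i) j a)
  last-visit ε a≢i = inj₁ (a≢i , ε)
  last-visit {i} {x} (e ◅ w) a≢i with last-visit w a≢i
  ... | inj₂ found = inj₂ found
  ... | inj₁ (z≢i , w′) with x ≟ i
  ...   | yes refl = inj₂ (_ , e , z≢i , w′)
  ...   | no  x≢i  = inj₁ (x≢i , (e , x≢i , z≢i) ◅ w′)

  branch : ∀ i a → a ≢ i → ∃[ j ] (Edge T i j × j ≢ i × Star (Off i) j a)
  branch i a a≢i with last-visit (proj₂ (proj₁ tree) i a) a≢i
  ... | inj₁ (i≢i , _) = contradiction refl i≢i
  ... | inj₂ found = found

  -- Following f through the tree never turns back, so each step shrinks the branch ahead.
  no-escape : (f : Fin n → Fin n) → (∀ i → Edge T i (f i)) → (∀ i → f i ≢ i) → (∀ i → f (f i) ≢ i) → Fin n → ⊥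
  no-escape f f-edge f≢ ff≢ i₀ with Fin.pigeonhole (ℕ.n<1+n n) (λ t → orbit (toℕ t))
    where
    orbit : ℕ → Fin n
    orbit = fold i₀ f
  -- The orbit repeats by the pigeonhole principle, yet a later position lies ahead of every earlier
  -- one and so differs from it.
  ... | s , t , s<t , eq = proj₁ (ahead-orbit (toℕ t ∸ suc (toℕ s)) (toℕ s))
          (trans (cong orbit (ℕ.m∸n+n≡m s<t)) (sym eq))
    where
    orbit : ℕ → Fin n
    orbit = fold i₀ f
    Ahead : Fin n → Fin n → Set
    Ahead i a = a ≢ i × Star (Off i) a (f i)
    shrink : ∀ i {a} → Ahead (f i) a → Ahead i a
    shrink i (a≢ , w) = go w a≢
      where
      j = f i
      go : ∀ {a} → Star (Off j) a (f j) → a ≢ j → Ahead i a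
      go {a} w a≢j with a ≟ i
      -- A walk from `i` to `f j` off `j`, followed by the step to `j`, would bypass the edge
      -- between `i` and `j`; `ff≢` keeps this last step from being that edge.
      ... | yes refl = contradiction
        (Star.map (λ (e , x≢ , y≢) → e , λ { (refl , refl) → y≢ refl }) w
          ◅◅ (ed-sym (f-edge j) , λ { (eq , _) → ff≢ i eq }) ◅ ε)
        (bridge (ed-sym (f-edge i)))
      go ε a≢j | no a≢i = a≢i , (ed-sym (f-edge j) , a≢i , f≢ i) ◅ ε
      go (_◅_ {j = z} (e , x≢ , z≢) w) a≢j | no a≢i with go w z≢
      ... | z≢i , w′ = a≢i , (e , a≢i , z≢i) ◅ w′
    ahead-orbit : ∀ d s → Ahead (orbit s) (orbit (d + suc s))
    ahead-orbit zero    s = f≢ _ , ε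
    ahead-orbit (suc d) s = shrink (orbit s) (subst (λ k → Ahead (orbit (suc s)) (orbit k)) (ℕ.+-suc d (suc s)) (ahead-orbit d (suc s)))

-- Existence of a balanced disk

module Decomposed {m : ℕ} (G : Graph (suc m)) (joined : ∀ u v → Walk G u v)
                  (D : TreeDecomposition G) (b : ℕ)
                  (disks : ∀ i → ∃[ v ] (∀ u → u ∈ₛ TreeDecomposition.bag D i → InDisk G b v u)) where

  open Stretch G joined
  open TreeDecomposition D
  open TreeBranches tree isTree

  module Unbalanced (s : State) (conn : ConnectedClasses (proj₁ s)) where

    q : V → V
    q = proj₁ s

    hub : Fin nodes → V
    hub i = proj₁ (disks i)

    ballAt : Fin nodes → V → Bool
    ballAt i = ball q (hub i) b

    module At (i : Fin nodes) where
      open Balls q (hub i) public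
      open Regions q (ballAt i) public

    -- A walk of G is also a path of the contracted graph of the same length, so contraction can
    -- only enlarge a ball.
    bag⊆ball : ∀ i {x} → x ∈ₛ bag i → x ∈ᵇ ballAt i
    bag⊆ball i {x} x∈ with proj₂ (disks i) x x∈
    ... | d , ((w , refl) , _) , d≤b = B-mono (ℕ.≤-trans (ℕ.≤-reflexive (ℕ.+-identityʳ d)) d≤b) x
      (path⇒∈B (λ _ _ e → e) 0 (B-zero-intro refl) (reverseₚ adj-sym (Path-map (λ _ _ → cong q) (λ _ _ e → e) (walk⇒path G w))))
      where open At i

    module _ (unbalanced : ∀ i → ∃[ u ] (u ∉ᵇ ballAt i × heavy (proj₂ s) (component q (ballAt i) u) ≡ true)) where

      u : Fin nodes → V
      u i = proj₁ (unbalanced i)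

      K : Fin nodes → V → Bool
      K i = component q (ballAt i) (u i)

      off : ∀ i {x} → x ∉ᵇ ballAt i → ∀ {a} → x ∈ₛ bag a → a ≢ i
      off i x∉ x∈ refl = x∉ (bag⊆ball i x∈)

      along : ∀ i {a a′} {x : V} → x ∉ᵇ ballAt i → (w : Walk tree a a′) → All (λ k → x ∈ₛ bag k) (vertices w) → Star (Off i) a a′
      along i x∉ ε _ = ε
      along i x∉ (e ◅ ε) (x∈ ∷ x∈′ ∷ []) = (e , off i x∉ x∈ , off i x∉ x∈′) ◅ ε
      along i x∉ (e ◅ w@(_ ◅ _)) (x∈ ∷ all@(x∈′ ∷ _)) = (e , off i x∉ x∈ , off i x∉ x∈′) ◅ along i x∉ w all

      -- A vertex off the ball is in no bag at node `i`, so the subtree of nodes whose bags hold it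
      -- lies in one branch at `i`.
      share : ∀ i {x a a′} → x ∉ᵇ ballAt i → x ∈ₛ bag a → x ∈ₛ bag a′ → Star (Off i) a a′
      share i {x} {a} {a′} x∉ x∈ x∈′ with nodesSubtree x a a′ x∈ x∈′
      ... | w , all = along i x∉ w all

      move : ∀ i {x y a a′} → x ∉ᵇ ballAt i → x ∈ₛ bag a → y ∈ₛ bag a′ → Star (Inside (_∉ᵇ ballAt i)) x y → Star (Off i) a a′
      move i x∉ x∈ y∈ ε = share i x∉ x∈ y∈
      move i x∉ x∈ y∈ (_◅_ {j = z} (e , _ , z∉) w) with coversEdge _ z e
      ... | c , x∈c , z∈c = share i x∉ x∈ x∈c ◅◅ move i z∉ z∈c y∈ w

      -- The decomposition knows only the edges of G, so a jump in a fibre is replaced by a walk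
      -- there; the walk misses the ball because balls are unions of fibres.
      links⇒inside : ∀ i {x y} → Star (At.Link i) x y → Star (Inside (_∉ᵇ ballAt i)) x y
      links⇒inside i ε = ε
      links⇒inside i (inj₁ l ◅ w) = l ◅ links⇒inside i w
      links⇒inside i (inj₂ (eq , x∉ , _) ◅ w) =
        Inside-map (λ z e z∈ → x∉ (At.B-class i b e z∈)) (conn _ _ eq) ◅◅ links⇒inside i w

      home : V → Fin nodes
      home x = proj₁ (coversVertex x)

      home∈ : ∀ x → x ∈ₛ bag (home x)
      home∈ x = proj₂ (coversVertex x)

      reach : ∀ i {x} → x ∈ᵇ K i → Star (Off i) (home (u i)) (home x)
      reach i {x} x∈ = move i u∉ (home∈ (u i)) (home∈ x) (links⇒inside i (proj₁ (At.C-sound i u∉ x∈)))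
        where u∉ = proj₁ (proj₂ (unbalanced i))

      branchOf : ∀ i → ∃[ j ] (Edge tree i j × j ≢ i × Star (Off i) j (home (u i)))
      branchOf i = branch i (home (u i)) (off i (proj₁ (proj₂ (unbalanced i))) (home∈ (u i)))

      f : Fin nodes → Fin nodes
      f i = proj₁ (branchOf i)

      -- Each of the two holds more than half of W. Were they disjoint, each would hold strictly
      -- more of W than the other.
      common : ∀ i j → ∃[ x ] (x ∈ᵇ K i × x ∈ᵇ K j)
      common i j with any (λ x → K i x ∧ K j x) in eq
      ... | true with any-elim _ eq
      ...   | x , h = x , ∧-elim {K i x} h
      common i j | false = contradiction (ℕ.<-trans (strict i j λ x p p′ → none x p p′) (strict j i λ x p p′ → none x p′ p)) (ℕ.<-irrefl refl)
        where
        none : ∀ x → x ∈ᵇ K i → x ∈ᵇ K j → ⊥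
        none x p p′ = contradiction (trans (sym eq) (any-intro _ x (∧-intro p p′))) λ ()
        W = proj₂ s
        strict : ∀ i j → (∀ x → x ∈ᵇ K i → x ∈ᵇ K j → ⊥) →
                 count (λ x → W x ∧ K j x) < count (λ x → W x ∧ K i x)
        strict i j dis = ℕ.≤-<-trans
          (count-mono _ _ λ x h → let p , p′ = ∧-elim {W x} h in ∧-intro p (not-intro λ pi → dis x pi p′))
          (heavy-sound W (K i) (proj₂ (proj₂ (unbalanced i))))

      -- Otherwise a vertex common to both heavy regions has a bag that is reached from `f i`
      -- without passing `i` and from `i` without passing `f i`, so the edge between these nodes
      -- would not be a bridge.
      f-forward : ∀ i → f (f i) ≢ i
      f-forward i eq with common i (f i)
      ... | x , x∈ , x∈′ = bridge e
        (Star.map (λ (e′ , _ , y≢) → e′ , λ (_ , y≡) → y≢ y≡) (proj₂ (proj₂ (proj₂ (branchOf i))) ◅◅ reach i x∈)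
         ◅◅ Star.map (λ (e′ , x≢ , _) → e′ , λ (x≡ , _) → x≢ x≡)
              (off-sym (subst (λ k → Star (Off (f i)) k (home x)) eq (proj₂ (proj₂ (proj₂ (branchOf (f i)))) ◅◅ reach (f i) x∈′))))
        where e = proj₁ (proj₂ (branchOf i))

      impossible : ⊥
      impossible = no-escape f (λ i → proj₁ (proj₂ (branchOf i))) (λ i → proj₁ (proj₂ (proj₂ (branchOf i)))) f-forward (home zero)

  balanced-disk : ∀ s → ConnectedClasses (proj₁ s) → ∃[ v ] ∃[ r ] (toℕ r ≤ b × balanced s v r ≡ true)
  balanced-disk s conn with b ℕ.≤? m
  -- Radii are indices and end at m. For larger `b` the ball of radius m is already everything, and
  -- no region is left outside it.
  ... | no b≰m = zero , fromℕ m , subst (_≤ b) (sym (Fin.toℕ-fromℕ m)) (ℕ.<⇒≤ (ℕ.≰⇒> b≰m)) ,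
    not-intro λ h → let u , h′ = any-elim _ h in
      not-elim (proj₁ (∧-elim {not (ball (proj₁ s) zero (toℕ (fromℕ m)) u)} h′))
        (subst (λ k → u ∈ᵇ ball (proj₁ s) zero k) (sym (Fin.toℕ-fromℕ m)) (Balls.B-full (proj₁ s) zero u))
  ... | yes b≤m with any (λ v → balanced s v (fromℕ< (s≤s b≤m))) in eq
  ...   | true with any-elim _ eq
  ...     | v , bal = v , fromℕ< (s≤s b≤m) , ℕ.≤-reflexive (Fin.toℕ-fromℕ< (s≤s b≤m)) , bal
  balanced-disk s conn | yes b≤m | false = ⊥-elim (impossible λ i → extract i (heavyRegion (hub i)))
    where
    open Unbalanced s conn
    heavyRegion : ∀ v → any (λ u → not (ball q v b u) ∧ heavy (proj₂ s) (component q (ball q v b) u)) ≡ true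
    heavyRegion v with any (λ u → not (ball q v b u) ∧ heavy (proj₂ s) (component q (ball q v b) u)) in eq′
    ... | true  = refl
    ... | false = contradiction (trans (sym eq) (any-intro (λ v → balanced s v (fromℕ< (s≤s b≤m))) v
      (cong not (subst (λ k → any (λ u → not (ball q v k u) ∧ heavy (proj₂ s) (component q (ball q v k) u)) ≡ false)
        (sym (Fin.toℕ-fromℕ< (s≤s b≤m))) eq′)))) λ ()
    extract : ∀ i → any (λ u → not (ballAt i u) ∧ heavy (proj₂ s) (component q (ballAt i) u)) ≡ true →
              ∃[ u ] (u ∉ᵇ ballAt i × heavy (proj₂ s) (component q (ballAt i) u) ≡ true)
    extract i h with any-elim _ h
    ... | u , h′ with ∧-elim {not (ballAt i u)} h′
    ...   | u∉ , hv = u , not-elim u∉ , hv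

-- The collective system of spanning trees

module _ {m : ℕ} (G : Graph (suc m)) (joined : ∀ u v → Walk G u v) where
  open Stretch G joined

  spanningTree : ℕ → Graph (suc m)
  spanningTree i = record
    { adj         = spanner i
    ; symmetric   = λ u v → ≡-from-⇔ (forest-sym i initial u v) (forest-sym i initial v u)
    ; irreflexive = λ v → Bool.¬-not λ h → Bool.not-¬ (Graph.irreflexive G v) (forest-edge i initial v v h)
    }

  spanningTree-spans : ∀ i → IsSpanningTree G (spanningTree i)
  spanningTree-spans i = record
    { isTree   = (_ , λ u v → proj₁ (path⇒walk T (proj₂ (forest-connected i initial u v))))
               , independent⇒acyclic T (forest-independent i initial)
    ; subgraph = forest-edge i initial
    }
    where T = spanningTree i

  -- The list is descending because the program accumulates its output by prepending.
  collective : ∀ ρ b → TreeBreadth G b → b ≤ ρ →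
    IsCollectiveTreeSpanners G ⌊log₂ suc m ⌋ ⌊ 2 * ρ ·log₂ suc m ⌋ (applyDownFrom spanningTree ⌊log₂ suc m ⌋)
  collective ρ b ((D , disks , _) , _) b≤ρ = record
    { atMost   = ℕ.≤-reflexive (List.length-applyDownFrom spanningTree ⌊log₂ suc m ⌋)
    ; spanning = All.applyDownFrom⁺₂ spanningTree _ spanningTree-spans
    ; stretch  = stretched
    }
    where
    good : BalancedWithin ρ
    good s conn with Decomposed.balanced-disk G joined D b disks s conn
    ... | v , r , r≤b , bal = v , r , ℕ.≤-trans r≤b b≤ρ , bal
    stretched : ∀ x y → x ≢ y → _
    stretched x y x≢y with distance≤ G (joined x y)
    ... | d , dist@((w , refl) , _) , _ with stretch good ⌊log₂ suc m ⌋ initial (λ { x y refl → ε })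
            (subst (_< 2 ^ suc ⌊log₂ suc m ⌋) (sym (count-true (suc m))) (n<2^1+⌊log₂⌋ (suc m))) {x} {y} refl refl x≢y (walk⇒path G w)
    ...   | i , i< , l , l≤ , p with path⇒walk (spanningTree i) p
    ...     | w′ , refl with distance≤ (spanningTree i) w′
    ...       | a , dist′ , a≤ = Any.applyDownFrom⁺ spanningTree
      (a , d , dist′ , dist , ℕ.≤-trans a≤ (ℕ.≤-trans l≤ (ℕ.+-monoʳ-≤ d (⌊log₂⌋*≤ (suc m) (2 * ρ))))) i<

-- Polynomial running time

record Poly (f : ℕ → ℕ) : Set where
  constructor poly
  field
    coefficient exponent : ℕ
    bounded : ∀ m → f m ≤ coefficient * suc m ^ exponent

poly-const : ∀ c → Poly (λ _ → c)
poly-const c = poly c 0 λ _ → ℕ.≤-reflexive (sym (ℕ.*-identityʳ c))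

poly-size : Poly suc
poly-size = poly 1 1 λ m → ℕ.≤-reflexive (sym (trans (ℕ.*-identityˡ _) (ℕ.^-identityʳ (suc m))))

-- The sum of the exponents serves as a common upper bound for them; the base `suc m` is at least 1,
-- so raising the exponent is harmless.
poly-+ : ∀ {f g} → Poly f → Poly g → Poly (λ m → f m + g m)
poly-+ {f} {g} (poly a j p) (poly b k q) = poly (a + b) (j + k) λ m → begin
  f m + g m                                      ≤⟨ ℕ.+-mono-≤ (p m) (q m) ⟩
  a * suc m ^ j + b * suc m ^ k                  ≤⟨ ℕ.+-mono-≤
    (ℕ.*-monoʳ-≤ a (ℕ.^-monoʳ-≤ (suc m) (ℕ.m≤m+n j k))) (ℕ.*-monoʳ-≤ b (ℕ.^-monoʳ-≤ (suc m) (ℕ.m≤n+m k j))) ⟩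
  a * suc m ^ (j + k) + b * suc m ^ (j + k)      ≡⟨ ℕ.*-distribʳ-+ (suc m ^ (j + k)) a b ⟨
  (a + b) * suc m ^ (j + k)                      ∎
  where open ℕ.≤-Reasoning

poly-* : ∀ {f g} → Poly f → Poly g → Poly (λ m → f m * g m)
poly-* {f} {g} (poly a j p) (poly b k q) = poly (a * b) (j + k) λ m → begin
  f m * g m                              ≤⟨ ℕ.*-mono-≤ (p m) (q m) ⟩
  (a * suc m ^ j) * (b * suc m ^ k)      ≡⟨ ℕ.[m*n]*[o*p]≡[m*o]*[n*p] a _ b _ ⟩
  (a * b) * (suc m ^ j * suc m ^ k)      ≡⟨ cong ((a * b) *_) (ℕ.^-distribˡ-+-* (suc m) j k) ⟨
  (a * b) * suc m ^ (j + k)              ∎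
  where open ℕ.≤-Reasoning

poly-suc : ∀ {f} → Poly f → Poly (suc ∘ f)
poly-suc = poly-+ (poly-const 1)

infix 3 _⊢_⇓_within_

_⊢_⇓_within_ : ∀ {A B} → Prog A B → ⟦ A ⟧ → ⟦ B ⟧ → ℕ → Set
p ⊢ x ⇓ y within T = ∃[ t ] ((p ⊢ x ⇓ y ⟨ t ⟩) × t ≤ T)

-- Correctness and cost are stated for a whole family of inputs described by `X m`, with one bound
-- per size, so that combinators compose both at once.
record Run {A B} (p : Prog A B) (X : ℕ → Set)
           (input : ∀ m → X m → ⟦ A ⟧) (output : ∀ m → X m → ⟦ B ⟧) : Set where
  constructor mkRun
  field
    cost    : ℕ → ℕ
    isPoly  : Poly cost
    correct : ∀ m x → p ⊢ input m x ⇓ output m x within cost m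

open Run

module _ {X : ℕ → Set} where

  private variable
    A B C S : Ty

  constantTime : {p : Prog A B} {i : ∀ m → X m → ⟦ A ⟧} {o : ∀ m → X m → ⟦ B ⟧} (c : ℕ) →
                 (∀ m x → p ⊢ i m x ⇓ o m x ⟨ c ⟩) → Run p X i o
  constantTime c h = mkRun (λ _ → c) (poly-const c) λ m x → c , h m x , ℕ.≤-refl

  module _ {i : ∀ m → X m → ⟦ A ⟧} where

    skipᴿ : Run skip X i i
    skipᴿ = constantTime 1 λ _ _ → skip

    unitᴿ : Run unit X i (λ _ _ → tt)
    unitᴿ = constantTime 1 λ _ _ → unit

    nilᴿ : Run (nil {B = B}) X i (λ _ _ → [])
    nilᴿ = constantTime 1 λ _ _ → nil

    inlᴿ : Run (inl {B = B}) X i (λ m x → inj₁ (i m x))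
    inlᴿ = constantTime 1 λ _ _ → inl

    inrᴿ : Run (inr {A = B}) X i (λ m x → inj₂ (i m x))
    inrᴿ = constantTime 1 λ _ _ → inr

    infixr 5 _⨾ᴿ_

    _⨾ᴿ_ : {p : Prog A B} {q : Prog B C} {o : ∀ m → X m → ⟦ B ⟧} {o′ : ∀ m → X m → ⟦ C ⟧} →
           Run p X i o → Run q X o o′ → Run (p ⨾ q) X i o′
    P ⨾ᴿ Q = mkRun (λ m → suc (cost P m + cost Q m)) (poly-suc (poly-+ (isPoly P) (isPoly Q))) λ m x →
      let _ , d , s≤ = correct P m x ; _ , e , t≤ = correct Q m x in _ , d ⨾ e , s≤s (ℕ.+-mono-≤ s≤ t≤)

    pairᴿ : {p : Prog A B} {q : Prog A C} {o : ∀ m → X m → ⟦ B ⟧} {o′ : ∀ m → X m → ⟦ C ⟧} →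
            Run p X i o → Run q X i o′ → Run (pair p q) X i (λ m x → o m x , o′ m x)
    pairᴿ P Q = mkRun (λ m → suc (cost P m + cost Q m)) (poly-suc (poly-+ (isPoly P) (isPoly Q))) λ m x →
      let _ , d , s≤ = correct P m x ; _ , e , t≤ = correct Q m x in _ , pair d e , s≤s (ℕ.+-mono-≤ s≤ t≤)

    substᴿ : {p : Prog A B} {o o′ : ∀ m → X m → ⟦ B ⟧} → (∀ m x → o m x ≡ o′ m x) → Run p X i o → Run p X i o′
    substᴿ {p = p} eq P = mkRun (cost P) (isPoly P) λ m x →
      subst (λ y → p ⊢ i m x ⇓ y within cost P m) (eq m x) (correct P m x)

  module _ {i : ∀ m → X m → ⟦ A ⟧} {j : ∀ m → X m → ⟦ B ⟧} where

    fstᴿ : Run fst X (λ m x → i m x , j m x) i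
    fstᴿ = constantTime 1 λ _ _ → fst

    sndᴿ : Run snd X (λ m x → i m x , j m x) j
    sndᴿ = constantTime 1 λ _ _ → snd

  consᴿ : {i : ∀ m → X m → ⟦ A ⟧} {j : ∀ m → X m → List ⟦ A ⟧} →
          Run cons X (λ m x → i m x , j m x) (λ m x → i m x ∷ j m x)
  consᴿ = constantTime 1 λ _ _ → cons

inputᴿ : ∀ {X A B} {p : Prog A B} {i i′ : ∀ m → X m → ⟦ A ⟧} {o} → (∀ m x → i m x ≡ i′ m x) → Run p X i o → Run p X i′ o
inputᴿ {p = p} {o = o} eq P = mkRun (cost P) (isPoly P) λ m x →
  subst (λ y → p ⊢ y ⇓ o m x within cost P m) (eq m x) (correct P m x)

precompose : ∀ {X Y : ℕ → Set} {A B} {p : Prog A B} {i o} (f : ∀ m → Y m → X m) →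
             Run p X i o → Run p Y (λ m y → i m (f m y)) (λ m y → o m (f m y))
precompose f P = mkRun (cost P) (isPoly P) λ m y → correct P m (f m y)

-- Conditionals and loops with cost bounds

constant : ∀ {A} → Bool → Prog A bit
constant false = unit ⨾ inl
constant true  = unit ⨾ inr

cond : ∀ {A B} → Prog A bit → Prog A B → Prog A B → Prog A B
-- `false` is left-tagged, so the alternative `r` comes first.
cond p q r = pair p skip ⨾ case (snd ⨾ r) (snd ⨾ q)

module _ {X : ℕ → Set} {A : Ty} {i : ∀ m → X m → ⟦ A ⟧} where

  constᴿ : (b : Bool) → Run (constant b) X i (λ _ _ → encodeBool b)
  constᴿ false = unitᴿ ⨾ᴿ inlᴿ
  constᴿ true  = unitᴿ ⨾ᴿ inrᴿ

  condᴿ : ∀ {B} {p : Prog A bit} {q r : Prog A B} {b : ∀ m → X m → Bool} {o o′ : ∀ m → X m → ⟦ B ⟧} →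
          Run p X i (λ m x → encodeBool (b m x)) → Run q X i o → Run r X i o′ →
          Run (cond p q r) X i (λ m x → if b m x then o m x else o′ m x)
  condᴿ {p = p} {q} {r} {b} {o} {o′} P Q R = pairᴿ P skipᴿ ⨾ᴿ mkRun
    (λ m → 3 + (cost Q m + cost R m))
    (poly-+ (poly-const 3) (poly-+ (isPoly Q) (isPoly R))) branches
    where
    branches : ∀ m x → case (snd ⨾ r) (snd ⨾ q) ⊢ (encodeBool (b m x) , i m x) ⇓
      (if b m x then o m x else o′ m x) within 3 + (cost Q m + cost R m)
    branches m x with b m x
    ... | true  = let _ , d , t≤ = correct Q m x in
      _ , case₂ (snd ⨾ d) , s≤s (s≤s (s≤s (ℕ.≤-trans t≤ (ℕ.m≤m+n _ _))))
    ... | false = let _ , d , t≤ = correct R m x in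
      _ , case₁ (snd ⨾ d) , s≤s (s≤s (s≤s (ℕ.≤-trans t≤ (ℕ.m≤n+m _ _))))

forEach : ∀ {A S E} → Prog (A ⊗ (S ⊗ E)) S → Prog (list A ⊗ (S ⊗ E)) S
forEach p = loop (pair (fst ⨾ uncons) snd ⨾
  case (snd ⨾ fst ⨾ inr)
       (pair (fst ⨾ snd) (pair (pair (fst ⨾ fst) snd ⨾ p) (snd ⨾ snd)) ⨾ inl))

module _ {A S E : Ty} {p : Prog (A ⊗ (S ⊗ E)) S} {I Σ′ : Set} (encI : I → ⟦ A ⟧) (encS : Σ′ → ⟦ S ⟧)
         (e : ⟦ E ⟧) (step : I → Σ′ → Σ′) {T : ℕ}
         (body : ∀ a s → p ⊢ (encI a , (encS s , e)) ⇓ encS (step a s) within T) where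

  -- 24 is the overhead of one turn of the loop besides its body, and 13 the cost of the turn that
  -- finds the list empty.
  forEach-runs : ∀ as s → forEach p ⊢ (map encI as , (encS s , e)) ⇓ encS (foldl (flip step) s as)
                          within length as * (24 + T) + 13
  forEach-runs [] s = _ , stop (pair (fst ⨾ uncons-[]) snd ⨾ case₁ (snd ⨾ fst ⨾ inr)) , ℕ.≤-refl
  forEach-runs (a ∷ as) s =
    let t , d , t≤ = body a s
        w , r , w≤ = forEach-runs as (step a s)
    in _ , again (pair (fst ⨾ uncons-∷) snd ⨾
             case₂ (pair (fst ⨾ snd) (pair (pair (fst ⨾ fst) snd ⨾ d) (snd ⨾ snd)) ⨾ inl)) r ,
       (begin
         _                                           ≡⟨ rearrange t w ⟩
         (24 + t) + w                                ≤⟨ ℕ.+-mono-≤ (ℕ.+-monoʳ-≤ 24 t≤) w≤ ⟩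
         (24 + T) + (length as * (24 + T) + 13)      ≡⟨ ℕ.+-assoc (24 + T) _ 13 ⟨
         suc (length as) * (24 + T) + 13             ∎)
    where
    open ℕ.≤-Reasoning
    rearrange : ∀ t w → suc (suc (5 + suc (suc (suc (3 + suc (suc (5 + t) + 3)) + 1))) + w) ≡ (24 + t) + w
    rearrange = solve-∀

module _ {X I Σ′ : ℕ → Set} {A S E : Ty} {p : Prog (A ⊗ (S ⊗ E)) S}
         (encI : ∀ m → I m → ⟦ A ⟧) (encS : ∀ m → Σ′ m → ⟦ S ⟧) (e : ∀ m → X m → ⟦ E ⟧)
         (step : ∀ m → X m → I m → Σ′ m → Σ′ m) where

  -- The body is specified for every accumulator in `Σ′ m`, not only those that occur. Its cost is
  -- thus the same bound in each turn and is multiplied by at most `suc m`.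
  forEachᴿ : Run p (λ m → I m × Σ′ m × X m) (λ m (a , s , x) → encI m a , (encS m s , e m x))
                 (λ m (a , s , x) → encS m (step m x a s)) →
             (as : ∀ m → X m → List (I m)) → (∀ m x → length (as m x) ≤ suc m) → (s : ∀ m → X m → Σ′ m) →
             Run (forEach p) X (λ m x → map (encI m) (as m x) , (encS m (s m x) , e m x))
                 (λ m x → encS m (foldl (flip (step m x)) (s m x) (as m x)))
  forEachᴿ P as short s = mkRun (λ m → suc m * (24 + cost P m) + 13)
    (poly-+ (poly-* poly-size (poly-+ (poly-const 24) (isPoly P))) (poly-const 13))
    λ m x → let t , d , t≤ = forEach-runs (encI m) (encS m) (e m x) (step m x)
                               (λ a s → correct P m (a , s , x)) (as m x) (s m x)
            in t , d , ℕ.≤-trans t≤ (ℕ.+-monoˡ-≤ 13 (ℕ.*-monoˡ-≤ (24 + cost P m) (short m x)))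

-- A first-order language of functions on {0, …, m}

infixr 7 _⊠_

-- There are no numbers beyond indices, and vectors have fixed length m + 1. Values cannot outgrow
-- their type and no loop exceeds m + 1 turns, so every term runs in polynomial time.
data STy : Set where
  bitˢ fin : STy
  _⊠_      : STy → STy → STy
  vec      : STy → STy

Ctx : Set
Ctx = List STy

⟪_⟫ : STy → ℕ → Set
⟪ bitˢ ⟫  m = Bool
⟪ fin ⟫   m = Fin (suc m)
⟪ A ⊠ B ⟫ m = ⟪ A ⟫ m × ⟪ B ⟫ m
⟪ vec A ⟫ m = Fin (suc m) → ⟪ A ⟫ m

Env : Ctx → ℕ → Set
Env []      m = ⊤
Env (A ∷ Γ) m = ⟪ A ⟫ m × Env Γ m

infix 4 _∋_
data _∋_ : Ctx → STy → Set where
  here  : ∀ {Γ A} → A ∷ Γ ∋ A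
  there : ∀ {Γ A B} → Γ ∋ A → B ∷ Γ ∋ A

lookupᵉ : ∀ {m Γ A} → Γ ∋ A → Env Γ m → ⟪ A ⟫ m
lookupᵉ here      (a , _) = a
lookupᵉ (there x) (_ , ρ) = lookupᵉ x ρ

-- Calls carry the meaning of the callee, so that evaluation never unfolds it.
mutual
  data Tm : Ctx → STy → Set where
    var      : ∀ {Γ A} → Γ ∋ A → Tm Γ A
    bool     : ∀ {Γ} → Bool → Tm Γ bitˢ
    ite      : ∀ {Γ A} → Tm Γ bitˢ → Tm Γ A → Tm Γ A → Tm Γ A
    and or   : ∀ {Γ} → Tm Γ bitˢ → Tm Γ bitˢ → Tm Γ bitˢ
    neg      : ∀ {Γ} → Tm Γ bitˢ → Tm Γ bitˢ
    tuple    : ∀ {Γ A B} → Tm Γ A → Tm Γ B → Tm Γ (A ⊠ B)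
    π₁       : ∀ {Γ A B} → Tm Γ (A ⊠ B) → Tm Γ A
    π₂       : ∀ {Γ A B} → Tm Γ (A ⊠ B) → Tm Γ B
    origin   : ∀ {Γ} → Tm Γ fin
    same     : ∀ {Γ} → Tm Γ fin → Tm Γ fin → Tm Γ bitˢ
    tab      : ∀ {Γ A} → Tm (fin ∷ Γ) A → Tm Γ (vec A)
    idx      : ∀ {Γ A} → Tm Γ (vec A) → Tm Γ fin → Tm Γ A
    folding  : ∀ {Γ A} → Tm (fin ∷ A ∷ Γ) A → Tm Γ A → Tm Γ A
    times    : ∀ {Γ A} → Tm Γ fin → Tm (A ∷ Γ) A → Tm Γ A → Tm Γ A
    call     : ∀ {Γ Δ A} → Def Δ A → Args Γ Δ → Tm Γ A

  data Args (Γ : Ctx) : Ctx → Set where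
    []  : Args Γ []
    _∷_ : ∀ {Δ A} → Tm Γ A → Args Γ Δ → Args Γ (A ∷ Δ)

  data Def (Δ : Ctx) (A : STy) : Set where
    define : (meaning : ∀ {m} → Env Δ m → ⟪ A ⟫ m) (body : Tm Δ A) →
             (∀ {m} (ρ : Env Δ m) → eval body ρ ≡ meaning ρ) → Def Δ A

  eval : ∀ {m Γ A} → Tm Γ A → Env Γ m → ⟪ A ⟫ m
  eval (var x)       ρ = lookupᵉ x ρ
  eval (bool b)      ρ = b
  eval (ite c t u)   ρ = if eval c ρ then eval t ρ else eval u ρ
  eval (and t u)     ρ = eval t ρ ∧ eval u ρ
  eval (or t u)      ρ = eval t ρ ∨ eval u ρ
  eval (neg t)       ρ = not (eval t ρ)
  eval (tuple t u)   ρ = eval t ρ , eval u ρ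
  eval (π₁ t)        ρ = proj₁ (eval t ρ)
  eval (π₂ t)        ρ = proj₂ (eval t ρ)
  eval origin        ρ = zero
  eval (same t u)    ρ = eval t ρ ≡ᵇ eval u ρ
  eval (tab t)       ρ = λ i → eval t (i , ρ)
  eval (idx t u)     ρ = eval t ρ (eval u ρ)
  eval (folding t u) ρ = foldFin (λ i a → eval t (i , a , ρ)) (eval u ρ)
  eval (times k t u) ρ = fold (eval u ρ) (λ a → eval t (a , ρ)) (toℕ (eval k ρ))
  eval (call (define meaning _ _) ts) ρ = meaning (evals ts ρ)

  evals : ∀ {m Γ Δ} → Args Γ Δ → Env Γ m → Env Δ m
  evals []       ρ = tt
  evals (t ∷ ts) ρ = eval t ρ , evals ts ρ

-- Compilation of terms to programs of polynomial cost

repr : STy → Ty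
repr bitˢ    = bit
repr fin     = list 𝟙
repr (A ⊠ B) = repr A ⊗ repr B
repr (vec A) = list (repr A)

-- The innermost component holds the list of all indices, over which every loop runs.
reprs : Ctx → Ty
reprs []      = list (list 𝟙)
reprs (A ∷ Γ) = repr A ⊗ reprs Γ

-- Unary indices reduce both lookup and comparison to dropping one list element per mark.
unary : ℕ → List ⊤
unary k = replicate k tt

enc : ∀ A {m} → ⟪ A ⟫ m → ⟦ repr A ⟧
enc bitˢ    b       = encodeBool b
enc fin     i       = unary (toℕ i)
enc (A ⊠ B) (a , b) = enc A a , enc B b
enc (vec A) f       = tabulate (enc A ∘ f)

-- `forEach` folds from the left while `foldFin` applies the function at `zero` last. The same order
-- lets `tab` build a vector by prepending.
descendingFins : ∀ m → List (Fin (suc m))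
descendingFins m = reverse (allFin (suc m))

indices : ℕ → List (List ⊤)
indices m = map (enc fin) (descendingFins m)

encs : ∀ Γ {m} → Env Γ m → ⟦ reprs Γ ⟧
encs []      {m} _ = indices m
encs (A ∷ Γ) (a , ρ) = enc A a , encs Γ ρ

base : ∀ Γ → Prog (reprs Γ) (list (list 𝟙))
base []      = skip
base (A ∷ Γ) = snd ⨾ base Γ

baseᴿ : ∀ Γ → Run (base Γ) (Env Γ) (λ m → encs Γ) (λ m _ → indices m)
baseᴿ []      = skipᴿ
baseᴿ (A ∷ Γ) = sndᴿ ⨾ᴿ precompose (λ m → proj₂) (baseᴿ Γ)

tail : ∀ {A} → Prog (list A) (list A)
tail = pair uncons unit ⨾ case nil (fst ⨾ snd)

tailᴿ : ∀ {X A} {i : ∀ m → X m → List ⟦ A ⟧} → Run tail X i (λ m x → drop 1 (i m x))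
tailᴿ {X} {A} {i} = mkRun (λ _ → 8) (poly-const 8) λ m x → go (i m x)
  where
  go : (xs : List ⟦ A ⟧) → tail ⊢ xs ⇓ drop 1 xs within 8
  go []       = _ , pair uncons-[] unit ⨾ case₁ nil , ℕ.m≤n+m _ 2
  go (x ∷ xs) = _ , pair uncons-∷ unit ⨾ case₂ (fst ⨾ snd) , ℕ.≤-refl

isEmpty : ∀ {A} → Prog (list A) bit
isEmpty = pair uncons unit ⨾ case (unit ⨾ inr) (unit ⨾ inl)

isEmptyᴿ : ∀ {X A} {i : ∀ m → X m → List ⟦ A ⟧} → Run isEmpty X i (λ m x → encodeBool (null (i m x)))
isEmptyᴿ {X} {A} {i} = mkRun (λ _ → 8) (poly-const 8) λ m x → go (i m x)
  where
  go : (xs : List ⟦ A ⟧) → isEmpty ⊢ xs ⇓ encodeBool (null xs) within 8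
  go []       = _ , pair uncons-[] unit ⨾ case₁ (unit ⨾ inr) , ℕ.≤-refl
  go (x ∷ xs) = _ , pair uncons-∷ unit ⨾ case₂ (unit ⨾ inl) , ℕ.≤-refl

-- The left branch of the case diverges; it is never reached.
head : ∀ {A} → Prog (list A) A
head = pair uncons unit ⨾ case (loop inl) (fst ⨾ fst)

headᴿ : ∀ {X A} {i : ∀ m → X m → ⟦ A ⟧} {j : ∀ m → X m → List ⟦ A ⟧} → Run head X (λ m x → i m x ∷ j m x) i
headᴿ = constantTime 8 λ m x → pair uncons-∷ unit ⨾ case₂ (fst ⨾ fst)

skipMany : ∀ {A} → Prog (list 𝟙 ⊗ list A) (list A)
skipMany = pair fst (pair snd unit) ⨾ forEach (snd ⨾ fst ⨾ tail)

foldl-drop : ∀ {A : Set} (xs : List A) k → foldl (λ s _ → drop 1 s) xs (unary k) ≡ drop k xs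
foldl-drop xs zero = refl
foldl-drop [] (suc k) = trans (foldl-drop [] k) (List.drop-[] k)
foldl-drop (x ∷ xs) (suc k) = foldl-drop xs k

skipManyᴿ : ∀ {X A} {k : ∀ m → X m → ℕ} {i : ∀ m → X m → List ⟦ A ⟧} → (∀ m x → k m x ≤ suc m) →
            Run skipMany X (λ m x → unary (k m x) , i m x) (λ m x → drop (k m x) (i m x))
skipManyᴿ {X} {A} {k} {i} k≤ = substᴿ (λ m x → foldl-drop (i m x) (k m x))
  (pairᴿ fstᴿ (pairᴿ sndᴿ unitᴿ) ⨾ᴿ inputᴿ (λ m x → cong (_, (i m x , tt)) (List.map-id (unary (k m x))))
    (forEachᴿ {X = X} {I = λ _ → ⊤} {Σ′ = λ _ → List ⟦ A ⟧}
      (λ _ a → a) (λ _ s → s) (λ _ _ → tt) (λ _ _ _ s → drop 1 s)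
      (sndᴿ ⨾ᴿ fstᴿ ⨾ᴿ tailᴿ) (λ m x → unary (k m x))
      (λ m x → subst (_≤ suc m) (sym (List.length-replicate (k m x))) (k≤ m x)) i))

-- Antisymmetry: each of the two lists is exhausted by dropping as many elements as the other has.
equal : Prog (list 𝟙 ⊗ list 𝟙) bit
equal = cond (skipMany ⨾ isEmpty) (pair snd fst ⨾ skipMany ⨾ isEmpty) (constant false)

null-drop : ∀ a b → null (drop a (unary b)) ≡ true → b ≤ a
null-drop zero    zero    _ = z≤n
null-drop (suc a) zero    _ = z≤n
null-drop (suc a) (suc b) h = s≤s (null-drop a b h)

drop-null : ∀ a → null (drop a (unary a)) ≡ true
drop-null zero    = refl
drop-null (suc a) = drop-null a

drop-antisym : ∀ {n} (i j : Fin n) →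
  (if null (drop (toℕ i) (unary (toℕ j))) then null (drop (toℕ j) (unary (toℕ i))) else false) ≡ (i ≡ᵇ j)
drop-antisym i j = ≡-from-⇔ forth back
  where
  forth : (if null (drop (toℕ i) (unary (toℕ j))) then null (drop (toℕ j) (unary (toℕ i))) else false) ≡ true →
          (i ≡ᵇ j) ≡ true
  forth h with null (drop (toℕ i) (unary (toℕ j))) in e
  ... | true = ≡ᵇ-complete (Fin.toℕ-injective (ℕ.≤-antisym (null-drop (toℕ j) (toℕ i) h) (null-drop (toℕ i) (toℕ j) e)))
  back : (i ≡ᵇ j) ≡ true →
         (if null (drop (toℕ i) (unary (toℕ j))) then null (drop (toℕ j) (unary (toℕ i))) else false) ≡ true
  back h with ≡ᵇ-sound h
  ... | refl rewrite drop-null (toℕ i) = refl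

if-float : ∀ {A B : Set} (f : A → B) b {x y : A} → (if b then f x else f y) ≡ f (if b then x else y)
if-float f true  = refl
if-float f false = refl

foldFin-foldr : ∀ {n} {A B : Set} (f : A → B → B) (b : B) (h : Fin n → A) →
                foldr f b (tabulate h) ≡ foldFin (λ i → f (h i)) b
foldFin-foldr {zero}  f b h = refl
foldFin-foldr {suc n} f b h = cong (f (h zero)) (foldFin-foldr f b (h ∘ suc))

foldl-descending : ∀ m {B : Set} (f : Fin (suc m) → B → B) (b : B) →
                   foldl (flip f) b (descendingFins m) ≡ foldFin f b
foldl-descending m f b = trans (sym (List.reverse-foldr f b (descendingFins m)))
  (trans (cong (foldr f b) (List.reverse-involutive (allFin (suc m)))) (foldFin-foldr f b id))

foldFin-tabulate : ∀ {n} {A : Set} (f : Fin n → A) → foldFin (λ i → f i ∷_) [] ≡ tabulate f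
foldFin-tabulate {zero}  f = refl
foldFin-tabulate {suc n} f = cong (f zero ∷_) (foldFin-tabulate (f ∘ suc))

foldl-unary : ∀ {A : Set} (f : A → A) (s : A) k → foldl (flip λ (_ : ⊤) → f) s (unary k) ≡ fold s f k
foldl-unary f s zero    = refl
foldl-unary f s (suc k) = trans (foldl-unary f (f s) k) (sym (fold-shift s f k))

drop-tabulate : ∀ {n} {A : Set} (f : Fin n → A) i →
                drop (toℕ i) (tabulate f) ≡ f i ∷ drop (suc (toℕ i)) (tabulate f)
drop-tabulate f zero    = refl
drop-tabulate f (suc i) = drop-tabulate (f ∘ suc) i

length-descending : ∀ m → length (descendingFins m) ≡ suc m
length-descending m = trans (List.length-reverse (allFin (suc m))) (List.length-tabulate id)

mutual
  compile : ∀ {Γ A} → Tm Γ A → Prog (reprs Γ) (repr A)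
  compile (var here)            = fst
  compile (var (there x))       = snd ⨾ compile (var x)
  compile (bool b)              = constant b
  compile (ite c t u)           = cond (compile c) (compile t) (compile u)
  compile (and t u)             = cond (compile t) (compile u) (constant false)
  compile (or t u)              = cond (compile t) (constant true) (compile u)
  compile (neg t)               = cond (compile t) (constant false) (constant true)
  compile (tuple t u)           = pair (compile t) (compile u)
  compile (π₁ t)                = compile t ⨾ fst
  compile (π₂ t)                = compile t ⨾ snd
  compile origin                = nil
  compile (same t u)            = pair (compile t) (compile u) ⨾ equal
  compile {Γ} (tab t)           = pair (base Γ) (pair nil skip) ⨾
    forEach (pair (pair fst (snd ⨾ snd) ⨾ compile t) (snd ⨾ fst) ⨾ cons)
  compile (idx t u)             = pair (compile u) (compile t) ⨾ skipMany ⨾ head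
  compile {Γ} (folding t u)     = pair (base Γ) (pair (compile u) skip) ⨾ forEach (compile t)
  compile (times k t u)         = pair (compile k) (pair (compile u) skip) ⨾ forEach (snd ⨾ compile t)
  compile (call (define _ t _) ts) = compileArgs ts ⨾ compile t

  compileArgs : ∀ {Γ Δ} → Args Γ Δ → Prog (reprs Γ) (reprs Δ)
  compileArgs {Γ} []   = base Γ
  compileArgs (t ∷ ts) = pair (compile t) (compileArgs ts)

mutual
  -- One induction on terms yields correctness and a polynomial bound together, so the algorithm
  -- below needs no cost analysis of its own.
  compileᴿ : ∀ {Γ A} (t : Tm Γ A) → Run (compile t) (Env Γ) (λ m → encs Γ) (λ m ρ → enc A (eval t ρ))
  compileᴿ (var here)                = fstᴿ
  compileᴿ {_ ∷ Γ} (var (there x))   = sndᴿ ⨾ᴿ precompose (λ m → proj₂) (compileᴿ {Γ} (var x))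
  compileᴿ (bool b)                  = constᴿ b
  compileᴿ {A = A} (ite c t u)       = substᴿ (λ m ρ → if-float (enc A) (eval c ρ)) (condᴿ (compileᴿ c) (compileᴿ t) (compileᴿ u))
  compileᴿ (and t u)                 = substᴿ (λ m ρ → case-∧ (eval t ρ)) (condᴿ (compileᴿ t) (compileᴿ u) (constᴿ false))
    where
    case-∧ : ∀ a {b} → (if a then encodeBool b else encodeBool false) ≡ encodeBool (a ∧ b)
    case-∧ true  = refl
    case-∧ false = refl
  compileᴿ (or t u)                  = substᴿ (λ m ρ → case-∨ (eval t ρ)) (condᴿ (compileᴿ t) (constᴿ true) (compileᴿ u))
    where
    case-∨ : ∀ a {b} → (if a then encodeBool true else encodeBool b) ≡ encodeBool (a ∨ b)
    case-∨ true  = refl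
    case-∨ false = refl
  compileᴿ (neg t)                   = substᴿ (λ m ρ → case-not (eval t ρ)) (condᴿ (compileᴿ t) (constᴿ false) (constᴿ true))
    where
    case-not : ∀ a → (if a then encodeBool false else encodeBool true) ≡ encodeBool (not a)
    case-not true  = refl
    case-not false = refl
  compileᴿ (tuple t u)               = pairᴿ (compileᴿ t) (compileᴿ u)
  compileᴿ (π₁ t)                    = compileᴿ t ⨾ᴿ fstᴿ
  compileᴿ (π₂ t)                    = compileᴿ t ⨾ᴿ sndᴿ
  compileᴿ origin                    = nilᴿ
  compileᴿ (same t u)                = pairᴿ (compileᴿ t) (compileᴿ u) ⨾ᴿ
    substᴿ (λ m ρ → trans (if-float encodeBool (null (drop (toℕ (eval t ρ)) (unary (toℕ (eval u ρ))))))
                          (cong encodeBool (drop-antisym (eval t ρ) (eval u ρ))))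
      (condᴿ (skipManyᴿ (λ m ρ → small (eval t ρ)) ⨾ᴿ isEmptyᴿ)
             (pairᴿ sndᴿ fstᴿ ⨾ᴿ skipManyᴿ (λ m ρ → small (eval u ρ)) ⨾ᴿ isEmptyᴿ) (constᴿ false))
  compileᴿ {Γ} {vec A} (tab t)       = pairᴿ (baseᴿ Γ) (pairᴿ nilᴿ skipᴿ) ⨾ᴿ
    substᴿ (λ m ρ → trans (foldl-descending m (λ i → enc A (eval t (i , ρ)) ∷_) []) (foldFin-tabulate (λ i → enc A (eval t (i , ρ)))))
      (forEachᴿ {I = λ m → Fin (suc m)} {Σ′ = λ m → List ⟦ repr A ⟧} (λ m → enc fin) (λ m s → s) (λ m → encs Γ)
        (λ m ρ i s → enc A (eval t (i , ρ)) ∷ s)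
        (pairᴿ (pairᴿ fstᴿ (sndᴿ ⨾ᴿ sndᴿ) ⨾ᴿ precompose (λ m (i , s , ρ) → i , ρ) (compileᴿ t)) (sndᴿ ⨾ᴿ fstᴿ) ⨾ᴿ consᴿ)
        (λ m _ → descendingFins m) (λ m _ → ℕ.≤-reflexive (length-descending m)) (λ _ _ → []))
  compileᴿ {A = A} (idx t u)         = pairᴿ (compileᴿ u) (compileᴿ t) ⨾ᴿ
    substᴿ (λ m ρ → drop-tabulate (enc A ∘ eval t ρ) (eval u ρ)) (skipManyᴿ λ m ρ → small (eval u ρ)) ⨾ᴿ headᴿ
  compileᴿ {Γ} {A} (folding t u)     = pairᴿ (baseᴿ Γ) (pairᴿ (compileᴿ u) skipᴿ) ⨾ᴿ
    substᴿ (λ m ρ → cong (enc A) (foldl-descending m (λ i a → eval t (i , a , ρ)) (eval u ρ)))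
      (forEachᴿ {I = λ m → Fin (suc m)} {Σ′ = ⟪ A ⟫} (λ m → enc fin) (λ m → enc A) (λ m → encs Γ)
        (λ m ρ i a → eval t (i , a , ρ)) (compileᴿ t)
        (λ m _ → descendingFins m) (λ m _ → ℕ.≤-reflexive (length-descending m)) (λ m ρ → eval u ρ))
  compileᴿ {Γ} {A} (times k t u)     = pairᴿ (compileᴿ k) (pairᴿ (compileᴿ u) skipᴿ) ⨾ᴿ
    inputᴿ (λ m ρ → cong (_, (enc A (eval u ρ) , encs Γ ρ)) (List.map-id (unary (toℕ (eval k ρ)))))
    (substᴿ (λ m ρ → cong (enc A) (foldl-unary (λ a → eval t (a , ρ)) (eval u ρ) (toℕ (eval k ρ))))
      (forEachᴿ {I = λ m → ⊤} {Σ′ = ⟪ A ⟫} (λ m a → a) (λ m → enc A) (λ m → encs Γ)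
        (λ m ρ _ a → eval t (a , ρ)) (sndᴿ ⨾ᴿ precompose (λ m → proj₂) (compileᴿ t))
        (λ m ρ → unary (toℕ (eval k ρ)))
        (λ m ρ → subst (_≤ suc m) (sym (List.length-replicate (toℕ (eval k ρ)))) (small (eval k ρ))) (λ m ρ → eval u ρ)))
  compileᴿ {A = A} (call (define _ t e) ts) = compileArgsᴿ ts ⨾ᴿ precompose (λ m ρ → evals ts ρ)
    (substᴿ (λ m ρ → cong (enc A) (e ρ)) (compileᴿ t))

  compileArgsᴿ : ∀ {Γ Δ} (ts : Args Γ Δ) → Run (compileArgs ts) (Env Γ) (λ m → encs Γ) (λ m ρ → encs Δ (evals ts ρ))
  compileArgsᴿ {Γ} []   = baseᴿ Γ
  compileArgsᴿ (t ∷ ts) = pairᴿ (compileᴿ t) (compileArgsᴿ ts)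

  small : ∀ {m} (i : Fin (suc m)) → toℕ i ≤ suc m
  small i = ℕ.<⇒≤ (Fin.toℕ<n i)

-- The algorithm as terms

setˢ matrixˢ labels stateˢ : STy
setˢ    = vec bitˢ
matrixˢ = vec setˢ
labels  = vec fin
stateˢ  = labels ⊠ setˢ

v0 : ∀ {A Γ} → Tm (A ∷ Γ) A
v0 = var here

v1 : ∀ {A B Γ} → Tm (B ∷ A ∷ Γ) A
v1 = var (there here)

v2 : ∀ {A B C Γ} → Tm (C ∷ B ∷ A ∷ Γ) A
v2 = var (there (there here))

v3 : ∀ {A B C D Γ} → Tm (D ∷ C ∷ B ∷ A ∷ Γ) A
v3 = var (there (there (there here)))

v4 : ∀ {A B C D E Γ} → Tm (E ∷ D ∷ C ∷ B ∷ A ∷ Γ) A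
v4 = var (there (there (there (there here))))

v5 : ∀ {A B C D E F Γ} → Tm (F ∷ E ∷ D ∷ C ∷ B ∷ A ∷ Γ) A
v5 = var (there (there (there (there (there here)))))

v6 : ∀ {A B C D E F G Γ} → Tm (G ∷ F ∷ E ∷ D ∷ C ∷ B ∷ A ∷ Γ) A
v6 = var (there (there (there (there (there (there here))))))

infixr 6 _∧ᵗ_
infixr 5 _∨ᵗ_
infixl 9 _!_

_∧ᵗ_ _∨ᵗ_ : ∀ {Γ} → Tm Γ bitˢ → Tm Γ bitˢ → Tm Γ bitˢ
_∧ᵗ_ = and
_∨ᵗ_ = or

_!_ : ∀ {Γ A} → Tm Γ (vec A) → Tm Γ fin → Tm Γ A
_!_ = idx

anyᵗ : Tm (setˢ ∷ []) bitˢ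
anyᵗ = folding (v2 ! v0 ∨ᵗ v1) (bool false)

findᵗ : Tm (setˢ ∷ []) fin
findᵗ = folding (ite (v2 ! v0) v0 v1) origin

opaque
  unfolding any find

  any-def : ∀ {m} (ρ : Env (setˢ ∷ []) m) → eval anyᵗ ρ ≡ any (proj₁ ρ)
  any-def _ = refl

  find-def : ∀ {m} (ρ : Env (setˢ ∷ []) m) → eval findᵗ ρ ≡ find (proj₁ ρ)
  find-def _ = refl

anyᵈ : Def (setˢ ∷ []) bitˢ
anyᵈ = define (λ ρ → any (proj₁ ρ)) anyᵗ any-def

findᵈ : Def (setˢ ∷ []) fin
findᵈ = define (λ ρ → find (proj₁ ρ)) findᵗ find-def

some : ∀ {Γ} → Tm (fin ∷ Γ) bitˢ → Tm Γ bitˢ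
some t = call anyᵈ (tab t ∷ [])

first : ∀ {Γ} → Tm (fin ∷ Γ) bitˢ → Tm Γ fin
first t = call findᵈ (tab t ∷ [])

growᵗ : Tm (matrixˢ ∷ setˢ ∷ []) setˢ
growᵗ = tab (v2 ! v0 ∨ᵗ some (v3 ! v0 ∧ᵗ v2 ! v0 ! v1))

opaque
  unfolding grow

  grow-def : ∀ {m} (ρ : Env (matrixˢ ∷ setˢ ∷ []) m) → eval growᵗ ρ ≡ (λ (R , S , _) → grow R S) ρ
  grow-def _ = refl

growᵈ : Def (matrixˢ ∷ setˢ ∷ []) setˢ
growᵈ = define (λ (R , S , _) → grow R S) growᵗ grow-def

spreadᵗ : Tm (matrixˢ ∷ setˢ ∷ fin ∷ []) setˢ
spreadᵗ = times v2 (call growᵈ (v1 ∷ v0 ∷ [])) v1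

closureᵗ : Tm (matrixˢ ∷ setˢ ∷ []) setˢ
closureᵗ = folding (call growᵈ (v2 ∷ v1 ∷ [])) v1

opaque
  unfolding spread closure

  spread-def : ∀ {m} (ρ : Env (matrixˢ ∷ setˢ ∷ fin ∷ []) m) → eval spreadᵗ ρ ≡ (λ (R , S , k , _) → spread R S (toℕ k)) ρ
  spread-def _ = refl

  closure-def : ∀ {m} (ρ : Env (matrixˢ ∷ setˢ ∷ []) m) → eval closureᵗ ρ ≡ (λ (R , S , _) → closure R S) ρ
  closure-def _ = refl

spreadᵈ : Def (matrixˢ ∷ setˢ ∷ fin ∷ []) setˢ
spreadᵈ = define (λ (R , S , k , _) → spread R S (toℕ k)) spreadᵗ spread-def

closureᵈ : Def (matrixˢ ∷ setˢ ∷ []) setˢ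
closureᵈ = define (λ (R , S , _) → closure R S) closureᵗ closure-def

open Algorithm

ballᵈ : Def (matrixˢ ∷ labels ∷ fin ∷ fin ∷ []) setˢ
ballᵈ = define (λ (G , q , v , k , _) → ball G q v (toℕ k))
  (call spreadᵈ (tab (tab (some (v3 ! v2 ! v0 ∧ᵗ same (v4 ! v0) (v4 ! v1)))) ∷ tab (same (v2 ! v3) (v2 ! v0)) ∷ v3 ∷ []))
  λ _ → refl

componentᵈ : Def (matrixˢ ∷ labels ∷ setˢ ∷ fin ∷ []) setˢ
componentᵈ = define (λ (G , q , D , u , _) → component G q D u)
  (call closureᵈ (tab (tab (neg (v4 ! v0) ∧ᵗ (v2 ! v1 ! v0 ∨ᵗ same (v3 ! v1) (v3 ! v0)))) ∷ tab (same v4 v0) ∷ []))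
  λ _ → refl

dropFirstᵈ : Def (setˢ ∷ []) setˢ
dropFirstᵈ = define (λ (S , _) → dropFirst S)
  (tab (v1 ! v0 ∧ᵗ neg (same v0 (call findᵈ (v1 ∷ []))))) λ _ → refl

heavyᵈ : Def (setˢ ∷ setˢ ∷ []) bitˢ
heavyᵈ = define (λ (W , K , _) → heavy W K)
  (call anyᵈ (folding (ite (v2 ! v0 ∧ᵗ neg (v3 ! v0)) (call dropFirstᵈ (v1 ∷ [])) v1) (tab (v1 ! v0 ∧ᵗ v2 ! v0)) ∷ []))
  λ _ → refl

balancedᵈ : Def (matrixˢ ∷ stateˢ ∷ fin ∷ fin ∷ []) bitˢ
balancedᵈ = define (λ (G , s , v , r , _) → balanced G s v r)
  (neg (some (neg (D ! v0) ∧ᵗ call heavyᵈ (π₂ v2 ∷ call componentᵈ (v1 ∷ π₁ v2 ∷ D ∷ v0 ∷ []) ∷ []))))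
  λ _ → refl
  where
  D : Tm (fin ∷ matrixˢ ∷ stateˢ ∷ fin ∷ fin ∷ []) setˢ
  D = call ballᵈ (v1 ∷ π₁ v2 ∷ v3 ∷ v4 ∷ [])

radiusᵗ : Tm (matrixˢ ∷ stateˢ ∷ []) fin
radiusᵗ = first (some (call balancedᵈ (v2 ∷ v3 ∷ v0 ∷ v1 ∷ [])))

opaque
  unfolding radius

  radius-def : ∀ {m} (ρ : Env (matrixˢ ∷ stateˢ ∷ []) m) → eval radiusᵗ ρ ≡ (λ (G , s , _) → radius G s) ρ
  radius-def _ = refl

radiusᵈ : Def (matrixˢ ∷ stateˢ ∷ []) fin
radiusᵈ = define (λ (G , s , _) → radius G s) radiusᵗ radius-def

centerᵗ : Tm (matrixˢ ∷ stateˢ ∷ []) fin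
centerᵗ = first (call balancedᵈ (v1 ∷ v2 ∷ v0 ∷ call radiusᵈ (v1 ∷ v2 ∷ []) ∷ []))

opaque
  unfolding center

  center-def : ∀ {m} (ρ : Env (matrixˢ ∷ stateˢ ∷ []) m) → eval centerᵗ ρ ≡ (λ (G , s , _) → center G s) ρ
  center-def _ = refl

centerᵈ : Def (matrixˢ ∷ stateˢ ∷ []) fin
centerᵈ = define (λ (G , s , _) → center G s) centerᵗ center-def

diskᵈ : Def (matrixˢ ∷ stateˢ ∷ []) setˢ
diskᵈ = define (λ (G , s , _) → disk G s)
  (call ballᵈ (v0 ∷ π₁ v1 ∷ call centerᵈ (v0 ∷ v1 ∷ []) ∷ call radiusᵈ (v0 ∷ v1 ∷ []) ∷ [])) λ _ → refl

regionᵈ : Def (matrixˢ ∷ stateˢ ∷ fin ∷ []) setˢ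
regionᵈ = define (λ (G , s , u , _) → region G s u)
  (call componentᵈ (v0 ∷ π₁ v1 ∷ call diskᵈ (v0 ∷ v1 ∷ []) ∷ v2 ∷ [])) λ _ → refl

focusᵈ : Def (matrixˢ ∷ stateˢ ∷ fin ∷ []) stateˢ
focusᵈ = define (λ (G , s , u , _) → focus G s u) (tuple
  (tab (ite (C ! v0) (π₁ v2 ! v0) (π₁ v2 ! call centerᵈ (v1 ∷ v2 ∷ []))))
  (tab (π₂ v2 ! v0 ∧ᵗ C ! v0))) λ _ → refl
  where
  C : Tm (fin ∷ matrixˢ ∷ stateˢ ∷ fin ∷ []) setˢ
  C = call regionᵈ (v1 ∷ v2 ∷ call findᵈ (call regionᵈ (v1 ∷ v2 ∷ v3 ∷ []) ∷ []) ∷ [])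

descendᵈ : Def (stateˢ ∷ matrixˢ ∷ fin ∷ fin ∷ []) stateˢ
descendᵈ = define (λ (s , G , u , v , _) → descend G u v s)
  (ite (D ! v2 ∧ᵗ D ! v3) v0 (call focusᵈ (v1 ∷ v0 ∷ ite (D ! v2) v3 v2 ∷ []))) λ _ → refl
  where
  D : Tm (stateˢ ∷ matrixˢ ∷ fin ∷ fin ∷ []) setˢ
  D = call diskᵈ (v1 ∷ v0 ∷ [])

entryᵈ : Def (matrixˢ ∷ labels ∷ fin ∷ fin ∷ fin ∷ []) fin
entryᵈ = define (λ (G , q , v , k , z , _) → entry G q v (toℕ k) z)
  (first (same (v2 ! v0) (v2 ! v5) ∧ᵗ some (call ballᵈ (v2 ∷ v3 ∷ v4 ∷ v5 ∷ []) ! v0 ∧ᵗ v2 ! v0 ! v1))) λ _ → refl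

parentᵗ : Tm (matrixˢ ∷ labels ∷ fin ∷ fin ∷ fin ∷ []) bitˢ
parentᵗ = v0 ! v3 ! v4 ∧ᵗ some (B ! v4 ∧ᵗ neg (B ! v5) ∧ᵗ
  same v5 (call entryᵈ (v1 ∷ v2 ∷ v3 ∷ v0 ∷ v5 ∷ [])) ∧ᵗ
  same v4 (first (call ballᵈ (v2 ∷ v3 ∷ v4 ∷ v1 ∷ []) ! v0 ∧ᵗ v2 ! v0 ! v6)))
  where
  B : Tm (fin ∷ matrixˢ ∷ labels ∷ fin ∷ fin ∷ fin ∷ []) setˢ
  B = call ballᵈ (v1 ∷ v2 ∷ v3 ∷ v0 ∷ [])

opaque
  unfolding parent

  parent-def : ∀ {m} (ρ : Env (matrixˢ ∷ labels ∷ fin ∷ fin ∷ fin ∷ []) m) →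
               eval parentᵗ ρ ≡ (λ (G , q , v , y , z , _) → parent G q v y z) ρ
  parent-def _ = refl

parentᵈ : Def (matrixˢ ∷ labels ∷ fin ∷ fin ∷ fin ∷ []) bitˢ
parentᵈ = define (λ (G , q , v , y , z , _) → parent G q v y z) parentᵗ parent-def

bfsᵗ : Tm (matrixˢ ∷ stateˢ ∷ fin ∷ fin ∷ []) bitˢ
bfsᵗ = call parentᵈ (v0 ∷ π₁ v1 ∷ c ∷ v2 ∷ v3 ∷ []) ∨ᵗ call parentᵈ (v0 ∷ π₁ v1 ∷ c ∷ v3 ∷ v2 ∷ [])
  where
  c : Tm (matrixˢ ∷ stateˢ ∷ fin ∷ fin ∷ []) fin
  c = call centerᵈ (v0 ∷ v1 ∷ [])

opaque
  unfolding bfs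

  bfs-def : ∀ {m} (ρ : Env (matrixˢ ∷ stateˢ ∷ fin ∷ fin ∷ []) m) → eval bfsᵗ ρ ≡ (λ (G , s , y , z , _) → bfs G s y z) ρ
  bfs-def _ = refl

bfsᵈ : Def (matrixˢ ∷ stateˢ ∷ fin ∷ fin ∷ []) bitˢ
bfsᵈ = define (λ (G , s , y , z , _) → bfs G s y z) bfsᵗ bfs-def

-- `tab` yields one matrix per index, m + 1 in all; `keepLog` cuts them down afterwards. The inner
-- tuple is the `initial` state.
spannersᵗ : Tm (matrixˢ ∷ []) (vec matrixˢ)
spannersᵗ = tab (tab (tab (v3 ! v1 ! v0 ∧ᵗ call bfsᵈ (v3 ∷
  times v2 (call descendᵈ (v0 ∷ v4 ∷ v2 ∷ v1 ∷ [])) (tuple (tab v0) (tab (bool true))) ∷ v1 ∷ v0 ∷ []))))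

opaque
  unfolding forest

  spanners-def : ∀ {m} (ρ : Env (matrixˢ ∷ []) m) → eval spannersᵗ ρ ≡ (λ (G , _) i → spanner G (toℕ i)) ρ
  spanners-def _ = refl

spannersᵈ : Def (matrixˢ ∷ []) (vec matrixˢ)
spannersᵈ = define (λ (G , _) i → spanner G (toℕ i)) spannersᵗ spanners-def

-- Reading the input size and truncating the output

enumerate : ∀ {A} → Prog (list A) (list 𝟙 ⊗ list (list 𝟙))
enumerate = pair skip (pair (pair nil nil) unit) ⨾
  forEach (pair (pair unit (snd ⨾ fst ⨾ fst) ⨾ cons) (pair (snd ⨾ fst ⨾ fst) (snd ⨾ fst ⨾ snd) ⨾ cons))

enumerate-foldl : ∀ {A : Set} (xs : List A) k →
  foldl (λ (s : List ⊤ × List (List ⊤)) _ → tt ∷ proj₁ s , proj₁ s ∷ proj₂ s) (unary k , applyDownFrom unary k) xs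
  ≡ (unary (k + length xs) , applyDownFrom unary (k + length xs))
enumerate-foldl [] k = cong (λ j → unary j , applyDownFrom unary j) (sym (ℕ.+-identityʳ k))
enumerate-foldl (x ∷ xs) k = trans (enumerate-foldl xs (suc k))
  (cong (λ j → unary j , applyDownFrom unary j) (sym (ℕ.+-suc k (length xs))))

tabulate-applyUpTo : ∀ {A : Set} (f : ℕ → A) n → tabulate {n = n} (f ∘ toℕ) ≡ applyUpTo f n
tabulate-applyUpTo f zero    = refl
tabulate-applyUpTo f (suc n) = cong (f zero ∷_) (tabulate-applyUpTo (f ∘ suc) n)

indices-descending : ∀ m → applyDownFrom unary (suc m) ≡ indices m
indices-descending m = sym (trans (List.reverse-map (enc fin) (allFin (suc m)))
  (trans (cong reverse (trans (List.map-tabulate id (enc fin)) (tabulate-applyUpTo unary (suc m))))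
    (List.reverse-applyUpTo unary (suc m))))

-- Compiled code expects the list of all indices in its environment. It is obtained by counting the
-- rows of the input matrix, each row recording the count so far.
enumerateᴿ : ∀ {A X} {rows : ∀ m → X m → List ⟦ A ⟧} → (∀ m x → length (rows m x) ≡ suc m) →
             Run enumerate X rows (λ m _ → unary (suc m) , indices m)
enumerateᴿ {A} {X} {rows} len = pairᴿ skipᴿ (pairᴿ (pairᴿ nilᴿ nilᴿ) unitᴿ) ⨾ᴿ
  inputᴿ (λ m x → cong (_, (([] , []) , tt)) (List.map-id (rows m x)))
  (substᴿ (λ m x → trans (enumerate-foldl (rows m x) 0)
             (trans (cong (λ j → unary j , applyDownFrom unary j) (len m x)) (cong (unary (suc m) ,_) (indices-descending m))))
    (forEachᴿ {X = X} {I = λ _ → ⟦ A ⟧} {Σ′ = λ _ → List ⊤ × List (List ⊤)} (λ _ a → a) (λ _ s → s) (λ _ _ → tt)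
      (λ _ _ _ s → tt ∷ proj₁ s , proj₁ s ∷ proj₂ s)
      (pairᴿ (pairᴿ unitᴿ (sndᴿ ⨾ᴿ fstᴿ ⨾ᴿ fstᴿ) ⨾ᴿ consᴿ) (pairᴿ (sndᴿ ⨾ᴿ fstᴿ ⨾ᴿ fstᴿ) (sndᴿ ⨾ᴿ fstᴿ ⨾ᴿ sndᴿ) ⨾ᴿ consᴿ))
      rows (λ m x → ℕ.≤-reflexive (len m x)) (λ _ _ → [] , [])))

-- The bit holds the parity of the elements read, and every second element emits a mark.
halve : Prog (list 𝟙) (list 𝟙)
halve = pair skip (pair (pair (constant false) nil) unit) ⨾ forEach
  (cond (snd ⨾ fst ⨾ fst) (pair (constant false) (pair unit (snd ⨾ fst ⨾ snd) ⨾ cons)) (pair (constant true) (snd ⨾ fst ⨾ snd))) ⨾ snd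

toggle : Bool × ℕ → Bool × ℕ
toggle (b , j) = if b then (false , suc j) else (true , j)

encodeToggle : Bool × ℕ → ⟦ bit ⊗ list 𝟙 ⟧
encodeToggle (b , j) = encodeBool b , unary j

toggle-foldl : ∀ k j → proj₂ (foldl (λ s (_ : ⊤) → toggle s) (false , j) (unary k)) ≡ j + ⌊ k /2⌋
toggle-foldl zero j = sym (ℕ.+-identityʳ j)
toggle-foldl (suc zero) j = sym (ℕ.+-identityʳ j)
toggle-foldl (suc (suc k)) j = trans (toggle-foldl k (suc j)) (sym (ℕ.+-suc j _))

halveᴿ : ∀ {X} {k : ∀ m → X m → ℕ} → (∀ m x → k m x ≤ suc m) →
         Run halve X (λ m x → unary (k m x)) (λ m x → unary ⌊ k m x /2⌋)
halveᴿ {X} {k} k≤ = pairᴿ skipᴿ (pairᴿ (pairᴿ (constᴿ false) nilᴿ) unitᴿ) ⨾ᴿ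
  inputᴿ (λ m x → cong (_, (encodeToggle (false , 0) , tt)) (List.map-id (unary (k m x))))
    (forEachᴿ {X = X} {I = λ _ → ⊤} {Σ′ = λ _ → Bool × ℕ} (λ _ a → a) (λ _ → encodeToggle) (λ _ _ → tt) (λ _ _ _ → toggle)
      (substᴿ (λ m (_ , (b , _) , _) → if-float encodeToggle b)
        (condᴿ (sndᴿ ⨾ᴿ fstᴿ ⨾ᴿ fstᴿ)
          (pairᴿ (constᴿ false) (pairᴿ unitᴿ (sndᴿ ⨾ᴿ fstᴿ ⨾ᴿ sndᴿ) ⨾ᴿ consᴿ))
          (pairᴿ (constᴿ true) (sndᴿ ⨾ᴿ fstᴿ ⨾ᴿ sndᴿ))))
      (λ m x → unary (k m x)) (λ m x → subst (_≤ suc m) (sym (List.length-replicate (k m x))) (k≤ m x)) (λ _ _ → false , 0))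
  ⨾ᴿ substᴿ (λ m x → cong unary (toggle-foldl (k m x) 0)) sndᴿ

n≤2^n : ∀ n → n ≤ 2 ^ n
n≤2^n zero    = z≤n
n≤2^n (suc n) = ℕ.+-mono-≤ (ℕ.m^n>0 2 n) (ℕ.≤-trans (n≤2^n n) (ℕ.m≤m+n (2 ^ n) 0))

⌊log₂⌋≤ : ∀ n → ⌊log₂ n ⌋ ≤ n
⌊log₂⌋≤ n = subst (⌊log₂ n ⌋ ≤_) (⌊log₂[2^n]⌋≡n n) (⌊log₂⌋-mono-≤ (n≤2^n n))

-- The counter starts at n and loses its last bit with each item read, so ⌊log₂ n⌋ items are kept.
keepLog : ∀ {A} → Prog (list 𝟙 ⊗ list A) (list A)
keepLog = pair snd (pair (pair fst nil) unit) ⨾ forEach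
  (pair (snd ⨾ fst ⨾ fst ⨾ halve) skip ⨾ pair fst
    (cond (fst ⨾ isEmpty) (snd ⨾ snd ⨾ fst ⨾ snd) (pair (snd ⨾ fst) (snd ⨾ snd ⨾ fst ⨾ snd) ⨾ cons))) ⨾ snd

module _ {A : Set} where

  -- The bound travels with the counter because the cost of `halve` has to be uniform over all
  -- accumulators.
  Counter : ℕ → Set
  Counter m = (Σ ℕ (_≤ suc m)) × List A

  keepStep : ∀ {m} → A → Counter m → Counter m
  keepStep a ((k , k≤) , kept) =
    (⌊ k /2⌋ , ℕ.≤-trans (ℕ.⌊n/2⌋≤n k) k≤) , (if null (unary ⌊ k /2⌋) then kept else a ∷ kept)

  keep-nothing : ∀ {m} k (k≤ : k ≤ suc m) as kept → ⌊ k /2⌋ ≡ 0 → proj₂ (foldl (flip keepStep) ((k , k≤) , kept) as) ≡ kept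
  keep-nothing k k≤ []       kept e = refl
  keep-nothing k k≤ (a ∷ as) kept e with ⌊ k /2⌋ | ℕ.≤-trans (ℕ.⌊n/2⌋≤n k) k≤ | e
  ... | .0 | 0≤ | refl = keep-nothing 0 0≤ as kept refl

  -- The logarithm of the counter is the number of items still to be kept: a halving lowers it by
  -- one, and from a counter of 1 or 0 nothing more is kept. `g` is the unread part of `f`, after
  -- the `i` items kept so far.
  keep-log : ∀ {m} (f : ℕ → A) L k (k≤ : k ≤ suc m) i (g : ℕ → A) → ⌊log₂ k ⌋ ≤ L → (∀ j → g j ≡ f (i + j)) →
             proj₂ (foldl (flip keepStep) ((k , k≤) , applyDownFrom f i) (applyUpTo g L)) ≡ applyDownFrom f (i + ⌊log₂ k ⌋)
  keep-log f L 0 k≤ i g _ _ = trans (keep-nothing 0 k≤ (applyUpTo g L) _ refl) (cong (applyDownFrom f) (sym (ℕ.+-identityʳ i)))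
  keep-log f L 1 k≤ i g _ _ = trans (keep-nothing 1 k≤ (applyUpTo g L) _ refl) (cong (applyDownFrom f) (sym (ℕ.+-identityʳ i)))
  keep-log f zero (suc (suc k)) k≤ i g log≤ _ = contradiction (subst (_≤ 0) (log-halve k) log≤) λ ()
  keep-log {m} f (suc L) (suc (suc k)) k≤ i g log≤ g≗f =
    trans (cong (λ a → proj₂ (foldl (flip keepStep) ((⌊ suc (suc k) /2⌋ , half≤) , a ∷ applyDownFrom f i) (applyUpTo (g ∘ suc) L)))
                (trans (g≗f 0) (cong f (ℕ.+-identityʳ i))))
    (trans (keep-log f L ⌊ suc (suc k) /2⌋ half≤ (suc i) (g ∘ suc) (s≤s⁻¹ (subst (_≤ suc L) (log-halve k) log≤))
              (λ j → trans (g≗f (suc j)) (cong f (ℕ.+-suc i j))))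
      (cong (applyDownFrom f) (trans (sym (ℕ.+-suc i _)) (cong (i +_) (sym (log-halve k))))))
    where
    half≤ : ⌊ suc (suc k) /2⌋ ≤ suc m
    half≤ = ℕ.≤-trans (ℕ.⌊n/2⌋≤n (suc (suc k))) k≤

keepLogᴿ : ∀ {A X} (f : ∀ m → X m → ℕ → ⟦ A ⟧) →
           Run (keepLog {A}) X (λ m x → unary (suc m) , tabulate {n = suc m} (f m x ∘ toℕ))
                         (λ m x → applyDownFrom (f m x) ⌊log₂ suc m ⌋)
keepLogᴿ {A} {X} f = pairᴿ sndᴿ (pairᴿ (pairᴿ fstᴿ nilᴿ) unitᴿ) ⨾ᴿ
  inputᴿ (λ m x → cong (_, ((unary (suc m) , []) , tt)) (trans (List.map-id _) (sym (tabulate-applyUpTo (f m x) (suc m)))))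
    (forEachᴿ {X = X} {I = λ _ → ⟦ A ⟧} {Σ′ = Counter} (λ _ a → a) (λ _ → encodeCounter) (λ _ _ → tt) (λ _ _ → keepStep)
      (pairᴿ (sndᴿ ⨾ᴿ fstᴿ ⨾ᴿ fstᴿ ⨾ᴿ halveᴿ (λ m (_ , ((k , k≤) , _) , _) → k≤)) skipᴿ ⨾ᴿ pairᴿ fstᴿ
        (condᴿ (fstᴿ ⨾ᴿ isEmptyᴿ) (sndᴿ ⨾ᴿ sndᴿ ⨾ᴿ fstᴿ ⨾ᴿ sndᴿ) (pairᴿ (sndᴿ ⨾ᴿ fstᴿ) (sndᴿ ⨾ᴿ sndᴿ ⨾ᴿ fstᴿ ⨾ᴿ sndᴿ) ⨾ᴿ consᴿ)))
      (λ m x → applyUpTo (f m x) (suc m)) (λ m x → ℕ.≤-reflexive (List.length-applyUpTo (f m x) (suc m)))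
      (λ m x → (suc m , ℕ.≤-refl) , []))
  ⨾ᴿ substᴿ (λ m x → keep-log (f m x) (suc m) (suc m) ℕ.≤-refl 0 (f m x) (⌊log₂⌋≤ (suc m)) (λ _ → refl)) sndᴿ
  where
  encodeCounter : ∀ {m} → Counter m → ⟦ list 𝟙 ⊗ list A ⟧
  encodeCounter ((k , _) , kept) = unary k , kept

main : Prog matrix (list matrix)
main = pair enumerate skip ⨾
  pair (fst ⨾ fst) (pair snd (fst ⨾ snd) ⨾ compile (call spannersᵈ (v0 ∷ []))) ⨾ keepLog

opaque
  mainᴿ : Run main (λ m → Graph (suc m)) (λ m → encode)
              (λ m G → applyDownFrom (λ i → enc matrixˢ (Algorithm.spanner (adj G) i)) ⌊log₂ suc m ⌋)
  mainᴿ = pairᴿ (enumerateᴿ (λ m G → List.length-tabulate (λ u → tabulate (λ v → encodeBool (adj G u v))))) skipᴿ ⨾ᴿ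
    pairᴿ (fstᴿ ⨾ᴿ fstᴿ)
      (pairᴿ sndᴿ (fstᴿ ⨾ᴿ sndᴿ) ⨾ᴿ precompose (λ m G → adj G , tt) (compileᴿ (call spannersᵈ (v0 ∷ [])))) ⨾ᴿ
    keepLogᴿ (λ m G i → enc matrixˢ (Algorithm.spanner (adj G) i))

theorem3 : (∀ {n} (G : Graph n) → Connected G →
    ∀ ρ b → TreeBreadth G b → b ≤ ρ →
    AdmitsCollectiveTreeSpanners G ⌊log₂ n ⌋ ⌊ 2 * ρ ·log₂ n ⌋)
    ×
    (Σ (Prog matrix (list matrix)) λ p → ∃[ c ] ∃[ k ]
    (∀ {n} (G : Graph n) → Connected G →
    ∀ ρ b → TreeBreadth G b → b ≤ ρ →
    ∃[ Ts ] ∃[ t ]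
    (IsCollectiveTreeSpanners G ⌊log₂ n ⌋ ⌊ 2 * ρ ·log₂ n ⌋ Ts
    × (p ⊢ encode G ⇓ map encode Ts ⟨ t ⟩)
    × t ≤ c * n ^ k)))
theorem3 = admits , main , coefficient , exponent , computed
  where
  open Poly (isPoly mainᴿ)
  computed : ∀ {n} (G : Graph n) → Connected G → ∀ ρ b → TreeBreadth G b → b ≤ ρ →
    ∃[ Ts ] ∃[ t ] (IsCollectiveTreeSpanners G ⌊log₂ n ⌋ ⌊ 2 * ρ ·log₂ n ⌋ Ts
      × (main ⊢ encode G ⇓ map encode Ts ⟨ t ⟩) × t ≤ coefficient * n ^ exponent)
  -- Connectedness includes having a vertex, which excludes `n = 0`.
  computed {zero}  G (record { nonZero = () } , _)
  computed {suc m} G (_ , joined) ρ b tb b≤ρ = Ts , proj₁ run , collective G joined ρ b tb b≤ρ ,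
    subst (λ out → main ⊢ encode G ⇓ out ⟨ proj₁ run ⟩)
      (sym (List.map-applyDownFrom (spanningTree G joined) encode ⌊log₂ suc m ⌋)) (proj₁ (proj₂ run)) ,
    ℕ.≤-trans (proj₂ (proj₂ run)) (bounded m)
    where
    Ts  = applyDownFrom (spanningTree G joined) ⌊log₂ suc m ⌋
    run = correct mainᴿ m G
  admits : ∀ {n} (G : Graph n) → Connected G → ∀ ρ b → TreeBreadth G b → b ≤ ρ →
    AdmitsCollectiveTreeSpanners G ⌊log₂ n ⌋ ⌊ 2 * ρ ·log₂ n ⌋
  admits G conn ρ b tb b≤ρ = proj₁ result , proj₁ (proj₂ (proj₂ result))
    where result = computed G conn ρ b tb b≤ρ
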